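{- Let $n\ge 7$ and let $M=(m_{ij})_{i,j=1}^n$ be an $n\times n$ array where each cell is colored red or blue. Then $M$ can be partitioned into $n$ balanced diagonals if and only if for each of the two colors there is a proper set of $n$ cells all colored with that color.
   Context: A diagonal of an $n\times n$ array is a set of $n$ cells no two of which lie in the same row or the same column. A diagonal in a 2-colored array is balanced if it contains at least one cell of each color. A set $A$ of cells of an $n\times n$ array is improper if there exist $i,j\in\{1,\dots,n\}$ such that every cell of $A$ lies either in row $i$ or in column $j$ but not in both (i.e., $A$ is contained in the union of row $i$ and column $j$ and does not contain the cell $(i,j)$); otherwise $A$ is proper. -}

module Defs where

open import Data.Nat using (ℕ)
open import Data.Fin using (Fin)
open import Data.Product using (Σ; ∃; ∃-syntax; _×_; _,_; proj₁; proj₂)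
open import Data.Sum using (_⊎_)
open import Relation.Nullary using (¬_)
open import Relation.Binary.PropositionalEquality using (_≡_)
open import Data.Fin.Permutation using (Permutation; _⟨$⟩ʳ_)
open import Function.Definitions using (Injective)


data Colour : Set where
  red blue : Colour

Cell : ℕ → Set
Cell n = Fin n × Fin n

Array : ℕ → Set
Array n = Cell n → Colour

-- A diagonal: n cells, no two in the same row or column, i.e. the
-- cells (i , σ i) for a permutation σ of Fin n.
Diagonal : ℕ → Set
Diagonal n = Permutation n n

_∈D_ : ∀ {n} → Cell n → Diagonal n → Set
(i , j) ∈D d = d ⟨$⟩ʳ i ≡ j

Balanced : ∀ {n} → Array n → Diagonal n → Set
Balanced {n} M d = ∀ (c : Colour) → ∃[ i ] M (i , d ⟨$⟩ʳ i) ≡ c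

BalancedPartition : ∀ {n} → Array n → Set
BalancedPartition {n} M =
  Σ (Fin n → Diagonal n) λ D →
    (∀ k → Balanced M (D k)) ×
    (∀ (x : Cell n) → ∃[ k ] (x ∈D D k × (∀ k′ → x ∈D D k′ → k′ ≡ k)))

-- A set of n cells, given by an injective enumeration Fin n → Cell n.
Improper : ∀ {n} → (Fin n → Cell n) → Set
Improper {n} A =
  ∃[ i ] ∃[ j ] ∀ (k : Fin n) →
    (proj₁ (A k) ≡ i ⊎ proj₂ (A k) ≡ j) × ¬ (A k ≡ (i , j))

Proper : ∀ {n} → (Fin n → Cell n) → Set
Proper A = ¬ Improper A

HasProperMonoSet : ∀ {n} → Array n → Colour → Set
HasProperMonoSet {n} M c =
  Σ (Fin n → Cell n) λ A →
    Injective _≡_ _≡_ A × (∀ k → M (A k) ≡ c) × Proper A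

{-# OPTIONS --safe #-}

-- Diagonals partitioning the array are the symbols of a Latin square, so the
-- task is to find a Latin square each of whose symbols meets both colours.
--
-- Every proper set R of n ≥ 7 cells is rainbow (its cells carry distinct symbols)
-- in some Latin square.  If a cell of R shares a row or column with another cell
-- of R, rows and columns can be ordered so that it lies on the main diagonal and
-- the rest of R strictly above; Smetaniuk's construction then reduces the problem
-- to the remaining cells in order n − 1.  Repeating this leaves a partial
-- transversal of size at least 3 (solved by a square with a rainbow diagonal), two
-- cells on a line, or two cells in each of two rows of a 4 × 4 array.
--
-- If colour c has no three cells in general position, then no diagonal has
-- colour c throughout, and a proper set of colour c made rainbow is enough.
-- Otherwise some colour c occurs at most n times in two of the first three rows,
-- and all its cells there extend to a proper set R of colour c.  When R is rainbow
-- every symbol meets colour c, and no symbol is entirely of colour c, since it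
-- would meet R in both of these rows.
module Submission where

open import Defs
open import Algebra.Properties.CommutativeSemigroup using (interchange)
open import Data.Fin as Fin using (Fin; zero; suc; toℕ; fromℕ<; inject₁; punchIn; punchOut)
open import Data.Fin.Patterns using (0F; 1F; 2F; 3F)
open import Data.Fin.Permutation using (permutation; _⟨$⟩ʳ_; _⟨$⟩ˡ_; inverseˡ)
import Data.Fin.Properties as Fin
open import Data.Fin.Properties using (_≟_; any?; all?; punchInᵢ≢i; punchIn-punchOut)
open import Data.List using (List; []; _∷_; _++_; length; map; filter; allFin; tabulate; lookup)
open import Data.List.Membership.Propositional using (_∈_; _∉_)
open import Data.List.Membership.Propositional.Properties using (∈-map⁺; ∈-map⁻; ∈-++⁺ˡ; ∈-++⁺ʳ; ∈-++⁻; ∈-filter⁺; ∈-filter⁻; ∈-allFin; ∈-tabulate⁺; ∈-tabulate⁻)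
import Data.List.Membership.DecPropositional as DecMembership
open import Data.List.Properties using (length-map; length-++; length-tabulate)
open import Data.List.Relation.Unary.All using (_∷_)
open import Data.List.Relation.Unary.AllPairs using (_∷_)
open import Data.List.Relation.Unary.Any using (here; there; index)
open import Data.List.Relation.Unary.Any.Properties using (lookup-index)
open import Data.List.Relation.Unary.Unique.Propositional using (Unique)
open import Data.List.Relation.Unary.Unique.Propositional.Properties using (allFin⁺; filter⁺)
open import Data.Nat as ℕ using (ℕ; zero; suc; _≤_; z≤n; s≤s; _+_; _*_; _∸_; _%_; _/_)
open import Data.Nat.Coprimality using (Coprime; coprime-divisor)
open import Data.Nat.DivMod using (m≡m%n+[m/n]*n; m%n<n; m<n⇒m%n≡m; %-distribˡ-+; m%n%n≡m%n)
open import Data.Nat.Divisibility using (_∣_; divides; ∣m+n∣m⇒∣n; m∣m*n; >⇒∤; ∣1⇒≡1; ∣-trans)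
import Data.Nat.Properties as ℕ
open import Data.Product using (Σ; ∃; ∃-syntax; _×_; _,_; proj₁; proj₂; swap)
open import Data.Product.Properties using (≡-dec)
import Data.Sum as Sum
open import Data.Sum using (_⊎_; inj₁; inj₂; [_,_]′)
import Data.Vec.Functional as Vector
open import Data.Vec.Functional using (insertAt)
open import Data.Vec.Functional.Properties using (insertAt-lookup; insertAt-punchIn)
open import Function using (_∘_; id)
open import Function.Bundles using (_⇔_; mk⇔)
open import Function.Definitions using (Injective)
open import Relation.Binary.Definitions using (tri<; tri≈; tri>)
open import Relation.Binary.PropositionalEquality using (_≡_; _≢_; refl; sym; trans; cong; cong₂; subst; subst₂; ≢-sym; module ≡-Reasoning)
open import Relation.Nullary using (¬_; Dec; yes; no; contradiction)
open import Relation.Nullary.Decidable using (_⊎-dec_; _×-dec_; _→-dec_; ¬?; decidable-stable; from-yes; map′)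
open import Relation.Unary using (Decidable)

private
  variable
    k m n : ℕ

Inj : {A B : Set} → (A → B) → Set
Inj f = Injective _≡_ _≡_ f

-- Injections between finite sets

missed : m ℕ.< n → (f : Fin m → Fin n) → ∃[ y ] ∀ x → f x ≢ y
missed {m} {n} m<n f
  with Fin.¬∀⟶∃¬ n (λ y → ∃[ x ] f x ≡ y) (λ y → any? (λ x → f x ≟ y)) ¬onto
  where
  ¬onto : ¬ (∀ y → ∃[ x ] f x ≡ y)
  ¬onto g = ℕ.<⇒≱ m<n (Fin.injective⇒≤ {f = proj₁ ∘ g}
    λ {y} {y′} eq → trans (sym (proj₂ (g y))) (trans (cong f eq) (proj₂ (g y′))))
... | y , ¬∃ = y , λ x eq → ¬∃ (x , eq)

inj⇒surj : (f : Fin n → Fin n) → Inj f → ∀ y → ∃[ x ] f x ≡ y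
inj⇒surj {suc n} f f-inj y with any? (λ x → f x ≟ y)
... | yes p = p
... | no ¬p = contradiction (Fin.injective⇒≤ {f = λ x → punchOut (y≢f x)}
                (λ {x} {x′} eq → f-inj (Fin.punchOut-injective (y≢f x) (y≢f x′) eq)))
                ℕ.1+n≰n
  where
  y≢f : ∀ x → y ≢ f x
  y≢f x eq = ¬p (x , sym eq)

data PunchView (i : Fin (suc n)) : Fin (suc n) → Set where
  here  : PunchView i i
  there : ∀ j → PunchView i (punchIn i j)

punchView : (i j : Fin (suc n)) → PunchView i j
punchView i j with i ≟ j
... | yes refl = here
... | no  i≢j  = subst (PunchView i) (punchIn-punchOut i≢j) (there (punchOut i≢j))

insertAt-inj : {B : Set} (f : Fin n → B) (i : Fin (suc n)) (b : B) →
  Inj f → (∀ j → f j ≢ b) → Inj (insertAt f i b)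
insertAt-inj f i b f-inj f≢b {x} {y} eq with punchView i x | punchView i y
... | here     | here     = refl
... | here     | there j  = contradiction
  (trans (sym (insertAt-punchIn f i b j)) (trans (sym eq) (insertAt-lookup f i b))) (f≢b j)
... | there j  | here     = contradiction
  (trans (sym (insertAt-punchIn f i b j)) (trans eq (insertAt-lookup f i b))) (f≢b j)
... | there j  | there j′ = cong (punchIn i) (f-inj
  (trans (sym (insertAt-punchIn f i b j)) (trans eq (insertAt-punchIn f i b j′))))

-- Latin squares

Square : ℕ → Set
Square n = Fin n → Fin n → Fin n

Latin : Square n → Set
Latin L = (∀ i → Inj (L i)) × (∀ j → Inj (λ i → L i j))

-- Column 0 of the result collects the symbol missing from each row; a symbol
-- missing from two rows would have to fit m columns into the m − 1 other rows.
addColumn : (X : Fin (suc m) → Fin m → Fin (suc m)) →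
  (∀ i → Inj (X i)) → (∀ j → Inj (λ i → X i j)) →
  ∃[ L ] Latin L × (∀ i j → L i (suc j) ≡ X i j)
addColumn {m} X rowInj colInj = L , (L-row , L-col) , λ _ _ → refl
  where
  miss : Fin (suc m) → Fin (suc m)
  miss i = proj₁ (missed ℕ.≤-refl (X i))

  miss∉ : ∀ i j → X i j ≢ miss i
  miss∉ i = proj₂ (missed ℕ.≤-refl (X i))

  L : Square (suc m)
  L i zero    = miss i
  L i (suc j) = X i j

  L-row : ∀ i → Inj (L i)
  L-row i {zero}  {zero}  _  = refl
  L-row i {zero}  {suc j} eq = contradiction (sym eq) (miss∉ i j)
  L-row i {suc j} {zero}  eq = contradiction eq (miss∉ i j)
  L-row i {suc j} {suc k} eq = cong suc (rowInj i eq)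

  miss-inj : Inj miss
  miss-inj {i} {i′} eq with i ≟ i′
  ... | yes i≡i′ = i≡i′
  ... | no  i≢i′ = contradiction (Fin.injective⇒≤ {f = g} g-inj) ℕ.1+n≰n
    where
    occ : ∀ j → ∃[ r ] X r j ≡ miss i
    occ j = inj⇒surj (λ r → X r j) (colInj j) (miss i)

    occ≢i : ∀ j → proj₁ (occ j) ≢ i
    occ≢i j e = miss∉ i j (trans (cong (λ r → X r j) (sym e)) (proj₂ (occ j)))

    occ≢i′ : ∀ j → proj₁ (occ j) ≢ i′
    occ≢i′ j e = miss∉ i′ j (trans (trans (cong (λ r → X r j) (sym e)) (proj₂ (occ j))) eq)

    g : Fin (suc (suc m)) → Fin (suc m)
    g zero          = i
    g (suc zero)    = i′
    g (suc (suc j)) = proj₁ (occ j)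

    g-inj : Inj g
    g-inj {zero}        {zero}        _ = refl
    g-inj {zero}        {suc zero}    e = contradiction e i≢i′
    g-inj {zero}        {suc (suc j)} e = contradiction (sym e) (occ≢i j)
    g-inj {suc zero}    {zero}        e = contradiction (sym e) i≢i′
    g-inj {suc zero}    {suc zero}    _ = refl
    g-inj {suc zero}    {suc (suc j)} e = contradiction (sym e) (occ≢i′ j)
    g-inj {suc (suc j)} {zero}        e = contradiction e (occ≢i j)
    g-inj {suc (suc j)} {suc zero}    e = contradiction e (occ≢i′ j)
    g-inj {suc (suc j)} {suc (suc l)} e = cong (λ x → Fin.suc (suc x))
      (rowInj (proj₁ (occ j)) (trans (proj₂ (occ j))
        (trans (sym (proj₂ (occ l))) (cong (λ r → X r l) (sym e)))))

  L-col : ∀ j → Inj (λ i → L i j)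
  L-col zero    = miss-inj
  L-col (suc j) = colInj j

-- Smetaniuk's construction

-- Column j carries the symbol y j and receives z j; it outputs one of the two
-- and goes on carrying the other.  The symbol 0 stands for "not yet active".
Exchange : (y h : Fin k → Fin (suc n)) (z : Fin k → Fin n) (o : Fin k → Fin (suc n)) → Fin k → Set
Exchange y h z o j = (h j ≡ y j × o j ≡ suc (z j)) ⊎ (h j ≡ suc (z j) × o j ≡ y j)

-- All inactive columns carry `zero` at the same time, so injectivity is asked only at the other
-- symbols.
Inj₀ : (Fin k → Fin (suc n)) → Set
Inj₀ y = ∀ {i j} → y i ≢ zero → y i ≡ y j → i ≡ j

-- Swapping column d makes it carry z d; if some other column carries z d
-- already, that column has to swap as well, and so on.
swapAt : (y : Fin (suc k) → Fin (suc n)) (z : Fin (suc k) → Fin n) (d : Fin (suc k)) →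
  Inj₀ y → Inj z → (∀ j → suc (z j) ≢ y d) →
  ∃[ h ] ∃[ o ] (h d ≡ suc (z d) × o d ≡ y d) × (∀ j → Exchange y h z o j) ×
    (∀ j → j ≢ d → y j ≡ zero → o j ≡ suc (z j)) × Inj₀ h × Inj o
swapAt {k} {n} y z d y-inj z-inj z≢yd with any? (λ j → y (punchIn d j) ≟ suc (z d))
... | no ¬∃ = h , o , (h-d , o-d) , exch , idle , h-inj ,
              insertAt-inj _ d (y d) (λ e → Fin.punchIn-injective d _ _ (z-inj (Fin.suc-injective e))) (λ j → z≢yd (punchIn d j))
  where
  h = insertAt (y ∘ punchIn d) d (suc (z d))
  o = insertAt (suc ∘ z ∘ punchIn d) d (y d)
  h-d : h d ≡ suc (z d)
  h-d = insertAt-lookup (y ∘ punchIn d) d _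
  o-d : o d ≡ y d
  o-d = insertAt-lookup (suc ∘ z ∘ punchIn d) d _
  h-p : ∀ j → h (punchIn d j) ≡ y (punchIn d j)
  h-p = insertAt-punchIn (y ∘ punchIn d) d _
  o-p : ∀ j → o (punchIn d j) ≡ suc (z (punchIn d j))
  o-p = insertAt-punchIn (suc ∘ z ∘ punchIn d) d _
  exch : ∀ j → Exchange y h z o j
  exch j with punchView d j
  ... | here    = inj₂ (h-d , o-d)
  ... | there i = inj₁ (h-p i , o-p i)
  idle : ∀ j → j ≢ d → y j ≡ zero → o j ≡ suc (z j)
  idle j j≢d _ with punchView d j
  ... | here    = contradiction refl j≢d
  ... | there i = o-p i
  h-inj : Inj₀ h
  h-inj {i} {j} hi≢0 eq with punchView d i | punchView d j
  ... | here    | here     = refl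
  ... | here    | there j′ = contradiction (j′ , trans (sym (h-p j′)) (trans (sym eq) h-d)) ¬∃
  ... | there i′ | here    = contradiction (i′ , trans (sym (h-p i′)) (trans eq h-d)) ¬∃
  ... | there i′ | there j′ = y-inj (λ e → hi≢0 (trans (h-p i′) e)) (trans (sym (h-p i′)) (trans eq (h-p j′)))
-- Delete column `d` and start again at `e`. The symbol carried by `e` is the one that `d` receives,
-- so no remaining column receives it and the hypothesis on the starting column holds again.
swapAt {suc k} {n} y z d y-inj z-inj z≢yd | yes (e , ye≡zd)
  with swapAt (y ∘ punchIn d) (z ∘ punchIn d) e
         (λ ≢0 eq → Fin.punchIn-injective d _ _ (y-inj ≢0 eq))
         (λ eq → Fin.punchIn-injective d _ _ (z-inj eq))
         (λ j eq → punchInᵢ≢i d j (z-inj (Fin.suc-injective (trans eq ye≡zd))))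
... | h′ , o′ , (h′-e , o′-e) , exch′ , idle′ , h′-inj , o′-inj =
  h , o , (h-d , o-d) , exch , idle , h-inj , insertAt-inj o′ d (y d) o′-inj o′≢yd
  where
  h = insertAt h′ d (suc (z d))
  o = insertAt o′ d (y d)
  h-d : h d ≡ suc (z d)
  h-d = insertAt-lookup h′ d _
  o-d : o d ≡ y d
  o-d = insertAt-lookup o′ d _
  h-p : ∀ j → h (punchIn d j) ≡ h′ j
  h-p = insertAt-punchIn h′ d _
  o-p : ∀ j → o (punchIn d j) ≡ o′ j
  o-p = insertAt-punchIn o′ d _
  exch : ∀ j → Exchange y h z o j
  exch j with punchView d j
  ... | here    = inj₂ (h-d , o-d)
  ... | there i with exch′ i
  ...   | inj₁ (p , q) = inj₁ (trans (h-p i) p , trans (o-p i) q)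
  ...   | inj₂ (p , q) = inj₂ (trans (h-p i) p , trans (o-p i) q)
  i≢e : ∀ i → y (punchIn d i) ≡ zero → i ≢ e
  i≢e i yi≡0 refl with () ← trans (sym yi≡0) ye≡zd
  idle : ∀ j → j ≢ d → y j ≡ zero → o j ≡ suc (z j)
  idle j j≢d yj≡0 with punchView d j
  ... | here    = contradiction refl j≢d
  ... | there i = trans (o-p i) (idle′ i (i≢e i yj≡0) yj≡0)
  z≢zd : ∀ i → suc (z (punchIn d i)) ≢ suc (z d)
  z≢zd i eq = punchInᵢ≢i d i (z-inj (Fin.suc-injective eq))
  h′≢zd : ∀ i → h′ i ≢ suc (z d)
  h′≢zd i eq with exch′ i
  ... | inj₂ (p , _) = z≢zd i (trans (sym p) eq)
  ... | inj₁ (p , _) = z≢zd e (trans (sym h′-e) (trans (cong h′ (sym i≡e)) eq))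
    where
    yi≡zd : y (punchIn d i) ≡ suc (z d)
    yi≡zd = trans (sym p) eq
    i≡e : i ≡ e
    i≡e = Fin.punchIn-injective d i e (y-inj (λ q → contradiction (trans (sym yi≡zd) q) λ ()) (trans yi≡zd (sym ye≡zd)))
  h-inj : Inj₀ h
  h-inj {i} {j} hi≢0 eq with punchView d i | punchView d j
  ... | here    | here     = refl
  ... | here    | there j′ = contradiction (trans (sym (h-p j′)) (trans (sym eq) h-d)) (h′≢zd j′)
  ... | there i′ | here    = contradiction (trans (sym (h-p i′)) (trans eq h-d)) (h′≢zd i′)
  ... | there i′ | there j′ = cong (punchIn d)
    (h′-inj (λ e → hi≢0 (trans (h-p i′) e)) (trans (sym (h-p i′)) (trans eq (h-p j′))))
  -- `Inj₀` is silent when `y d` is `zero`. The clause on idle columns covers this case: an inactive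
  -- column other than the start of the chain outputs what it receives.
  o′≢yd : ∀ i → o′ i ≢ y d
  o′≢yd i eq with exch′ i
  ... | inj₁ (_ , q) = z≢yd (punchIn d i) (trans (sym q) eq)
  ... | inj₂ (_ , q) with y (punchIn d i) ≟ zero
  ...   | no  yi≢0 = punchInᵢ≢i d i (y-inj yi≢0 (trans (sym q) eq))
  ...   | yes yi≡0 = contradiction (trans (sym (idle′ i (i≢e i yi≡0) yi≡0)) eq) (z≢yd (punchIn d i))

-- The shift from `(i , j)` to `(inject₁ i , suc j)` moves the cells on or above the old diagonal
-- strictly above the new one, which is filled with a new symbol. Nothing is promised below the
-- diagonal.
Prolongation : Square n → Set
Prolongation {n} L = ∃[ K ] Latin {suc n} K × (∀ i → K i i ≡ zero) ×
  (∀ i j → toℕ i ≤ toℕ j → K (inject₁ i) (suc j) ≡ suc (L i j))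

module Smetaniuk (L : Square (suc m)) (latin : Latin L) where

  private
    N = suc m

  -- The state after i rows.  Column j of L becomes column suc j of the
  -- prolongation, so it meets the diagonal in row suc j and carries 0 until then.
  record Stage (i : ℕ) : Set where
    field
      carry  : Fin N → Fin (suc N)
      inj    : Inj₀ carry
      idle   : ∀ j → i ≤ suc (toℕ j) → carry j ≡ zero
      -- At `i = N` only the last column escapes this condition, so the symbols carried at the end
      -- are distinct even though `Inj₀` ignores `zero`.
      active : ∀ j → suc (toℕ j) ℕ.< i → carry j ≢ zero
      seen   : ∀ j → carry j ≡ zero ⊎ ∃[ r ] toℕ r ℕ.< i × carry j ≡ suc (L r j)
  open Stage

  record Step {i : ℕ} (r : Fin N) (s : Stage i) : Set where
    field
      next   : Stage (suc i)
      out    : Fin N → Fin (suc N)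
      exch   : ∀ j → Exchange (carry s) (carry next) (L r) out j
      outInj : Inj out
      above  : ∀ j → i ≤ toℕ j → out j ≡ suc (L r j)
      diag   : ∀ j → i ≡ suc (toℕ j) → out j ≡ zero
  open Step

  step : ∀ {i} r → toℕ r ≡ i → (s : Stage i) → Step r s
  step zero refl s = record
    { next   = record
      { carry  = carry s
      ; inj    = inj s
      ; idle   = λ j _ → idle s j z≤n
      ; active = λ { _ (s≤s ()) }
      ; seen   = λ j → inj₁ (idle s j z≤n)
      }
    ; out    = λ j → suc (L zero j)
    ; exch   = λ _ → inj₁ (refl , refl)
    ; outInj = λ eq → proj₁ latin zero (Fin.suc-injective eq)
    ; above  = λ _ _ → refl
    ; diag   = λ _ ()
    }
  -- In this row the diagonal passes through column `suc d` with `d = inject₁ i′`. Column `d` still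
  -- carries `zero`, so starting the swaps there outputs `zero` on the diagonal and activates the
  -- column.
  step i@(suc i′) refl s
    with swapAt (carry s) (L i) (inject₁ i′) (inj s) (proj₁ latin i)
           (λ j eq → contradiction (trans eq c-d≡0) λ ())
    where
    c-d≡0 : carry s (inject₁ i′) ≡ zero
    c-d≡0 = idle s (inject₁ i′) (s≤s (ℕ.≤-reflexive (sym (Fin.toℕ-inject₁ i′))))
  ... | h , o , (h-d , o-d) , exch′ , idle′ , h-inj , o-inj = record
    { next   = record
      { carry  = h
      ; inj    = h-inj
      ; idle   = idle-h
      ; active = active-h
      ; seen   = seen-h
      }
    ; out    = o
    ; exch   = exch′
    ; outInj = o-inj
    ; above  = above-o
    ; diag   = diag-o
    }
    where
    d = inject₁ i′
    d≡ : toℕ d ≡ toℕ i′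
    d≡ = Fin.toℕ-inject₁ i′
    c-d≡0 : carry s d ≡ zero
    c-d≡0 = idle s d (s≤s (ℕ.≤-reflexive (sym d≡)))
    ≢d : ∀ j → toℕ i ≤ toℕ j → j ≢ d
    ≢d j i≤j refl = ℕ.<⇒≱ (ℕ.≤-reflexive (cong suc d≡)) i≤j
    above-o : ∀ j → toℕ i ≤ toℕ j → o j ≡ suc (L i j)
    above-o j i≤j = idle′ j (≢d j i≤j) (idle s j (ℕ.m≤n⇒m≤1+n i≤j))
    diag-o : ∀ j → toℕ i ≡ suc (toℕ j) → o j ≡ zero
    diag-o j eq = trans (cong o j≡d) (trans o-d c-d≡0)
      where
      j≡d : j ≡ d
      j≡d = Fin.toℕ-injective (trans (sym (ℕ.suc-injective eq)) (sym d≡))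
    idle-h : ∀ j → suc (toℕ i) ≤ suc (toℕ j) → h j ≡ zero
    idle-h j (s≤s i≤j) with exch′ j
    ... | inj₁ (p , _) = trans p (idle s j (ℕ.m≤n⇒m≤1+n i≤j))
    ... | inj₂ (_ , q) = contradiction
      (trans (sym (above-o j i≤j)) (trans q (idle s j (ℕ.m≤n⇒m≤1+n i≤j)))) λ ()
    active-h : ∀ j → suc (toℕ j) ℕ.< suc (toℕ i) → h j ≢ zero
    active-h j (s≤s j<i) hj≡0 with exch′ j
    ... | inj₂ (p , _) = contradiction (trans (sym p) hj≡0) λ ()
    ... | inj₁ (p , _) with ℕ.m≤n⇒m<n∨m≡n j<i
    ...   | inj₁ j<i′ = active s j j<i′ (trans (sym p) hj≡0)
    ...   | inj₂ j≡i′ = contradiction (trans (sym h-d) (trans (cong h (sym j≡d)) hj≡0)) λ ()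
      where
      j≡d : j ≡ d
      j≡d = Fin.toℕ-injective (trans (ℕ.suc-injective j≡i′) (sym d≡))
    seen-h : ∀ j → h j ≡ zero ⊎ ∃[ r ] toℕ r ℕ.< suc (toℕ i) × h j ≡ suc (L r j)
    seen-h j with exch′ j
    ... | inj₂ (p , _) = inj₂ (i , ℕ.≤-refl , p)
    ... | inj₁ (p , _) with seen s j
    ...   | inj₁ c≡0           = inj₁ (trans p c≡0)
    ...   | inj₂ (r , r<i , q) = inj₂ (r , ℕ.m≤n⇒m≤1+n r<i , trans p q)

  stage  : ∀ i → .(i ≤ N) → Stage i
  stepAt : ∀ i → .(p : i ℕ.< N) → Step (fromℕ< p) (stage i (ℕ.<⇒≤ p))
  stage zero    _ = record
    { carry  = λ _ → zero
    ; inj    = λ ≢0 _ → contradiction refl ≢0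
    ; idle   = λ _ _ → refl
    ; active = λ _ ()
    ; seen   = λ _ → inj₁ refl
    }
  stage (suc i) p = next (stepAt i p)
  stepAt i p = step (fromℕ< p) (Fin.toℕ-fromℕ< p) (stage i (ℕ.<⇒≤ p))

  new≢old : ∀ {i} .(p : i ℕ.< N) j r → toℕ r ℕ.< i → suc (L (fromℕ< p) j) ≢ suc (L r j)
  new≢old {i} p j r r<i eq = ℕ.<-irrefl (trans (cong toℕ (sym new≡r)) (Fin.toℕ-fromℕ< p)) r<i
    where
    new≡r : fromℕ< p ≡ r
    new≡r = proj₂ latin j (Fin.suc-injective eq)

  new≢carry : ∀ {i} .(p : i ℕ.< N) j → suc (L (fromℕ< p) j) ≢ carry (stage i (ℕ.<⇒≤ p)) j
  new≢carry {i} p j eq with seen (stage i (ℕ.<⇒≤ p)) j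
  ... | inj₁ c≡0           = contradiction (trans eq c≡0) λ ()
  ... | inj₂ (r , r<i , q) = new≢old p j r r<i (trans eq q)

  new≢out : ∀ {i r} .(p : i ℕ.< N) .(q : r ℕ.< N) j → r ℕ.< i →
    suc (L (fromℕ< p) j) ≢ out (stepAt r q) j
  new≢out {i} {r} p q j r<i eq with exch (stepAt r q) j
  ... | inj₁ (_ , o≡new) = new≢old p j (fromℕ< q)
    (subst (ℕ._< i) (sym (Fin.toℕ-fromℕ< q)) r<i) (trans eq o≡new)
  ... | inj₂ (_ , o≡c) with seen (stage r (ℕ.<⇒≤ q)) j
  ...   | inj₁ c≡0             = contradiction (trans eq (trans o≡c c≡0)) λ ()
  ...   | inj₂ (r′ , r′<r , e) = new≢old p j r′ (ℕ.<-trans r′<r r<i) (trans eq (trans o≡c e))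

  -- A symbol once output never returns to its column: each later step keeps the old carry or takes
  -- an entry of a new row of `L`, and that entry differs from everything the column has met so far.
  out≢carry : ∀ i r .(p : i ≤ N) .(q : r ℕ.< N) j → r ℕ.< i →
    out (stepAt r q) j ≢ carry (stage i p) j
  out≢carry (suc i) r p q j (s≤s r≤i) eq with ℕ.m≤n⇒m<n∨m≡n r≤i | exch (stepAt i p) j
  ... | inj₁ r<i  | inj₁ (h≡c , _) = out≢carry i r (ℕ.<⇒≤ p) q j r<i (trans eq h≡c)
  ... | inj₁ r<i  | inj₂ (h≡z , _) = new≢out p q j r<i (sym (trans eq h≡z))
  ... | inj₂ refl | inj₁ (h≡c , o≡z) = new≢carry p j (trans (sym o≡z) (trans eq h≡c))
  ... | inj₂ refl | inj₂ (h≡z , o≡c) = new≢carry p j (sym (trans (sym o≡c) (trans eq h≡z)))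

  out≢out : ∀ i r .(p : i ℕ.< N) .(q : r ℕ.< N) j → r ℕ.< i →
    out (stepAt r q) j ≢ out (stepAt i p) j
  out≢out i r p q j r<i eq with exch (stepAt i p) j
  ... | inj₁ (_ , o≡z) = new≢out p q j r<i (sym (trans eq o≡z))
  ... | inj₂ (_ , o≡c) = out≢carry i r (ℕ.<⇒≤ p) q j r<i (trans eq o≡c)

  -- `L` has `N` rows and the prolongation has one more; the last row consists of the symbols still
  -- carried.
  rows : ∀ {i} → i ≤ N → Fin N → Fin (suc N)
  rows {i} i≤N with ℕ.m≤n⇒m<n∨m≡n i≤N
  ... | inj₁ p = out (stepAt i p)
  ... | inj₂ _ = carry (stage N ℕ.≤-refl)

  rows-inj : ∀ {i} (p : i ≤ N) → Inj (rows p)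
  rows-inj {i} i≤N with ℕ.m≤n⇒m<n∨m≡n i≤N
  ... | inj₁ p = outInj (stepAt i p)
  ... | inj₂ _ = last-inj
    where
    c = carry (stage N ℕ.≤-refl)
    zero-last : ∀ j → c j ≡ zero → toℕ j ≡ m
    zero-last j eq with ℕ.m≤n⇒m<n∨m≡n (ℕ.s≤s⁻¹ (Fin.toℕ<n j))
    ... | inj₁ j<m = contradiction eq (active (stage N ℕ.≤-refl) j (s≤s j<m))
    ... | inj₂ j≡m = j≡m
    last-inj : Inj c
    last-inj {j} {l} eq with c j ≟ zero
    ... | no  cj≢0 = inj (stage N ℕ.≤-refl) cj≢0 eq
    ... | yes cj≡0 = Fin.toℕ-injective
      (trans (zero-last j cj≡0) (sym (zero-last l (trans (sym eq) cj≡0))))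

  rows-≢ : ∀ {i r} (p : i ≤ N) (q : r ≤ N) j → r ℕ.< i → rows q j ≢ rows p j
  rows-≢ {i} {r} p q j r<i with ℕ.m≤n⇒m<n∨m≡n p | ℕ.m≤n⇒m<n∨m≡n q
  ... | inj₁ p′   | inj₁ q′   = out≢out i r p′ q′ j r<i
  ... | inj₂ refl | inj₁ q′   = out≢carry N r ℕ.≤-refl q′ j r<i
  ... | inj₁ p′   | inj₂ refl = contradiction p′ (ℕ.<-asym r<i)
  ... | inj₂ refl | inj₂ refl = contradiction r<i (ℕ.<-irrefl refl)

  rows-above : ∀ {i} (p : i ≤ N) (r : Fin N) → toℕ r ≡ i → ∀ j → i ≤ toℕ j →
    rows p j ≡ suc (L r j)
  rows-above {i} p r refl j i≤j with ℕ.m≤n⇒m<n∨m≡n p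
  ... | inj₁ p′ = trans (above (stepAt i p′) j i≤j)
                        (cong (λ r → suc (L r j)) (Fin.fromℕ<-toℕ r p′))
  ... | inj₂ r≡N = contradiction (Fin.toℕ<n r) (ℕ.<-irrefl r≡N)

  rows-diag : ∀ {i} (p : i ≤ N) j → i ≡ suc (toℕ j) → rows p j ≡ zero
  rows-diag {i} p j i≡ with ℕ.m≤n⇒m<n∨m≡n p
  ... | inj₁ p′ = diag (stepAt i p′) j i≡
  ... | inj₂ i≡N = idle (stage N ℕ.≤-refl) j (ℕ.≤-reflexive (trans (sym i≡N) i≡))

  prolongation : Prolongation L
  prolongation = K , K-latin , K-diag , K-above
    where
    i≤N : (i : Fin (suc N)) → toℕ i ≤ N
    i≤N i = ℕ.s≤s⁻¹ (Fin.toℕ<n i)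
    X : Fin (suc N) → Fin N → Fin (suc N)
    X i = rows (i≤N i)
    X-col : ∀ j → Inj (λ i → X i j)
    X-col j {i} {i′} eq with ℕ.<-cmp (toℕ i) (toℕ i′)
    ... | tri< i<i′ _ _ = contradiction eq (rows-≢ (i≤N i′) (i≤N i) j i<i′)
    ... | tri≈ _ i≡i′ _ = Fin.toℕ-injective i≡i′
    ... | tri> _ _ i>i′ = contradiction (sym eq) (rows-≢ (i≤N i) (i≤N i′) j i>i′)
    ext = addColumn X (λ i → rows-inj (i≤N i)) X-col
    K = proj₁ ext
    K-latin = proj₁ (proj₂ ext)
    K-X : ∀ i j → K i (suc j) ≡ X i j
    K-X = proj₂ (proj₂ ext)
    K-above : ∀ i j → toℕ i ≤ toℕ j → K (inject₁ i) (suc j) ≡ suc (L i j)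
    K-above i j i≤j = trans (K-X (inject₁ i) j)
      (rows-above (i≤N (inject₁ i)) i (sym (Fin.toℕ-inject₁ i)) j
        (ℕ.≤-trans (ℕ.≤-reflexive (Fin.toℕ-inject₁ i)) i≤j))
    K-diag : ∀ i → K i i ≡ zero
    K-diag (suc j) = trans (K-X (suc j) j) (rows-diag (i≤N (suc j)) j refl)
    -- The rest of row `zero` is a copy of row `zero` of `L` and contains every `suc t`, which
    -- leaves only `zero` for the corner.
    K-diag zero with K zero zero in eq
    ... | zero  = refl
    ... | suc t with inj⇒surj (L zero) (proj₁ latin zero) t
    ...   | j , Lj≡t = contradiction
      (proj₁ K-latin zero {zero} {suc j} (trans eq (trans (cong suc (sym Lj≡t)) (sym (K-above zero j z≤n))))) λ ()

-- Triangular arrangements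

minor : Fin (suc n) → Fin (suc n) → List (Cell (suc n)) → List (Cell n)
minor w c []            = []
minor w c ((i , j) ∷ S) with w ≟ i | c ≟ j
... | no w≢i | no c≢j = (punchOut w≢i , punchOut c≢j) ∷ minor w c S
... | no _   | yes _  = minor w c S
... | yes _  | _      = minor w c S

minor-≤ : ∀ (w c : Fin (suc n)) S → length (minor w c S) ≤ length S
minor-≤ w c []            = z≤n
minor-≤ w c ((i , j) ∷ S) with w ≟ i | c ≟ j
... | no _  | no _  = s≤s (minor-≤ w c S)
... | no _  | yes _ = ℕ.m≤n⇒m≤1+n (minor-≤ w c S)
... | yes _ | _     = ℕ.m≤n⇒m≤1+n (minor-≤ w c S)

minor-< : ∀ (w c : Fin (suc n)) S {j} → (w , j) ∈ S → length (minor w c S) ℕ.< length S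
minor-< w c ((i , j) ∷ S) w∈S with w ≟ i | c ≟ j | w∈S
... | no w≢i | _     | here refl = contradiction refl w≢i
... | no _   | no _  | there p   = s≤s (minor-< w c S p)
... | no _   | yes _ | there p   = ℕ.m≤n⇒m≤1+n (minor-< w c S p)
... | yes _  | _     | _         = s≤s (minor-≤ w c S)

∈-minor⁺ : ∀ (w c : Fin (suc n)) S {i j} → (punchIn w i , punchIn c j) ∈ S → (i , j) ∈ minor w c S
∈-minor⁺ w c ((a , b) ∷ S) {i} {j} p with w ≟ a | c ≟ b | p
... | no w≢a  | no c≢b  | here refl = here (cong₂ _,_
  (sym (trans (Fin.punchOut-cong w refl) (Fin.punchOut-punchIn w)))
  (sym (trans (Fin.punchOut-cong c refl) (Fin.punchOut-punchIn c))))
... | no _    | yes c≡b | here refl = contradiction (sym c≡b) (punchInᵢ≢i c j)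
... | yes w≡a | _       | here refl = contradiction (sym w≡a) (punchInᵢ≢i w i)
... | no _    | no _    | there q   = there (∈-minor⁺ w c S q)
... | no _    | yes _   | there q   = ∈-minor⁺ w c S q
... | yes _   | _       | there q   = ∈-minor⁺ w c S q

∈-minor⁻ : ∀ (w c : Fin (suc n)) S {i j} → (i , j) ∈ minor w c S → (punchIn w i , punchIn c j) ∈ S
∈-minor⁻ w c ((a , b) ∷ S) p with w ≟ a | c ≟ b | p
... | no w≢a | no c≢b | here refl = here (cong₂ _,_ (punchIn-punchOut w≢a) (punchIn-punchOut c≢b))
... | no _   | no _   | there q   = there (∈-minor⁻ w c S q)
... | no _   | yes _  | q         = there (∈-minor⁻ w c S q)
... | yes _  | _      | q         = there (∈-minor⁻ w c S q)

emptyColumn : (S : List (Cell n)) → length S ℕ.< n → ∃[ c ] ∀ i → (i , c) ∉ S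
emptyColumn S S<n with missed S<n (proj₂ ∘ lookup S)
... | c , miss = c , λ i p → miss (index p) (cong proj₂ (sym (lookup-index p)))

toFront : Fin (suc n) → (Fin n → Fin n) → Fin (suc n) → Fin (suc n)
toFront w ρ = insertAt (suc ∘ ρ) w zero

toFront-here : ∀ (w : Fin (suc n)) ρ → toFront w ρ w ≡ zero
toFront-here w ρ = insertAt-lookup (suc ∘ ρ) w zero

toFront-there : ∀ (w : Fin (suc n)) ρ i → toFront w ρ (punchIn w i) ≡ suc (ρ i)
toFront-there w ρ = insertAt-punchIn (suc ∘ ρ) w zero

toFront-inj : ∀ (w : Fin (suc n)) {ρ} → Inj ρ → Inj (toFront w ρ)
toFront-inj w ρ-inj = insertAt-inj _ w zero (λ eq → ρ-inj (Fin.suc-injective eq)) (λ _ ())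

record Triangular (S : List (Cell n)) : Set where
  field
    ρ κ   : Fin n → Fin n
    ρ-inj : Inj ρ
    κ-inj : Inj κ
    upper : ∀ {i j} → (i , j) ∈ S → ρ i Fin.< κ j
open Triangular

-- Once an empty column stands first, any row may stand first: its cells all lie to the right of
-- position 0, and the remaining cells are arranged by the minor.
peel : ∀ (w c : Fin (suc n)) S → (∀ i → (i , c) ∉ S) → Triangular (minor w c S) → Triangular S
peel w c S c∉S t = record
  { ρ     = toFront w (ρ t)
  ; κ     = toFront c (κ t)
  ; ρ-inj = toFront-inj w (ρ-inj t)
  ; κ-inj = toFront-inj c (κ-inj t)
  ; upper = upper′
  }
  where
  upper′ : ∀ {i j} → (i , j) ∈ S → toFront w (ρ t) i Fin.< toFront c (κ t) j
  upper′ {i} {j} p with punchView c j | punchView w i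
  ... | here     | _       = contradiction p (c∉S i)
  ... | there j′ | here rewrite toFront-here w (ρ t) | toFront-there c (κ t) j′ = s≤s z≤n
  ... | there j′ | there i′ rewrite toFront-there w (ρ t) i′ | toFront-there c (κ t) j′ =
    s≤s (upper t (∈-minor⁺ w c S p))

-- Fewer cells than columns leave some column empty. Peeling it off with a row that contains a cell
-- removes at least one cell, so the bound passes to the minor.
triangular : (S : List (Cell n)) → length S ≤ ℕ.pred n → Triangular S
triangular {zero}  S _ = record
  { ρ = id ; κ = id ; ρ-inj = id ; κ-inj = id ; upper = λ { {()} } }
triangular {suc n} S len with emptyColumn S (s≤s len)
triangular {suc n} []                len | c , c∉S =
  peel zero c [] c∉S (triangular [] z≤n)
triangular {suc n} S@((w , _) ∷ _) len | c , c∉S =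
  peel w c S c∉S (triangular (minor w c S)
    (ℕ.<⇒≤pred (ℕ.<-≤-trans (minor-< w c S (here refl)) len)))

-- Rows meeting column v are moved to the front first; then column v is empty
-- and u and v themselves can come next.
triangularWithDiagonal : (S : List (Cell (suc n))) → length S ≤ n → ∀ u v j →
  (u , j) ∈ S → (u , v) ∉ S → Σ (Triangular S) λ t → ρ t u ≡ κ t v
triangularWithDiagonal {n} S len u v j u∈S uv∉S with any? (λ i → DecMembership._∈?_ (≡-dec _≟_ _≟_) (i , v) S)
... | no ¬∃ = peel u v S (λ i p → ¬∃ (i , p)) t ,
              trans (toFront-here u (ρ t)) (sym (toFront-here v (κ t)))
  where
  t = triangular (minor u v S) (ℕ.<⇒≤pred (ℕ.<-≤-trans (minor-< u v S u∈S) len))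
... | yes (w , w∈S) with w ≟ u | emptyColumn S (s≤s len)
...   | yes refl | _ = contradiction w∈S uv∉S
triangularWithDiagonal {zero} S len zero v j u∈S uv∉S | yes (zero , w∈S) | no w≢u | _ =
  contradiction refl w≢u
-- The empty column `c` is neither `v`, which contains `(w , v)`, nor `j`, which contains `(u , j)`.
-- Hence `u`, `v` and `j` all survive in the minor.
triangularWithDiagonal {suc n} S len u v j u∈S uv∉S | yes (w , w∈S) | no w≢u | c , c∉S =
  peel w c S c∉S t ,
  trans (cong (toFront w (ρ t)) (sym (punchIn-punchOut w≢u)))
    (trans (toFront-there w (ρ t) u′) (trans (cong suc ρu≡κv)
      (trans (sym (toFront-there c (κ t) v′)) (cong (toFront c (κ t)) (punchIn-punchOut c≢v)))))
  where
  c≢v : c ≢ v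
  c≢v refl = c∉S w w∈S
  c≢j : c ≢ j
  c≢j refl = c∉S u u∈S
  u′ = punchOut w≢u
  v′ = punchOut c≢v
  rec = triangularWithDiagonal (minor w c S)
    (ℕ.s≤s⁻¹ (ℕ.<-≤-trans (minor-< w c S w∈S) len)) u′ v′ (punchOut c≢j)
    (∈-minor⁺ w c S (subst₂ (λ a b → (a , b) ∈ S)
      (sym (punchIn-punchOut w≢u)) (sym (punchIn-punchOut c≢j)) u∈S))
    (λ p → uv∉S (subst₂ (λ a b → (a , b) ∈ S)
      (punchIn-punchOut w≢u) (punchIn-punchOut c≢v) (∈-minor⁻ w c S p)))
  t = proj₁ rec
  ρu≡κv = proj₂ rec

-- Rainbow cell families

row col : (Fin k → Cell n) → Fin k → Fin n
row A = proj₁ ∘ A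
col A = proj₂ ∘ A

Rainbow : (Fin k → Cell n) → Set
Rainbow {n = n} A = Σ (Square n) λ L → Latin L × Inj (λ k → L (row A k) (col A k))

Adj : (Fin k → Cell n) → Fin k → Fin k → Set
Adj A a b = row A a ≡ row A b ⊎ col A a ≡ col A b

transpose-rainbow : (A : Fin k → Cell n) → Rainbow (swap ∘ A) → Rainbow A
transpose-rainbow A (L , (r , c) , inj) = (λ i j → L j i) , (c , r) , inj

-- Each reduction renumbers rows and columns and lowers the order. What persists is which cells
-- share a row or a column, and the core configurations are recognised from that alone.
record SamePattern (A : Fin k → Cell m) (B : Fin k → Cell n) : Set where
  field
    row⁺ : ∀ {a b} → row A a ≡ row A b → row B a ≡ row B b
    row⁻ : ∀ {a b} → row B a ≡ row B b → row A a ≡ row A b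
    col⁺ : ∀ {a b} → col A a ≡ col A b → col B a ≡ col B b
    col⁻ : ∀ {a b} → col B a ≡ col B b → col A a ≡ col A b
open SamePattern

pattern-inj : {A : Fin k → Cell m} {B : Fin k → Cell n} → SamePattern A B → Inj A → Inj B
pattern-inj p A-inj eq = A-inj (cong₂ _,_ (row⁻ p (cong proj₁ eq)) (col⁻ p (cong proj₂ eq)))

Reduction : (Fin (suc m) → Cell (suc m)) → Fin (suc m) → Set
Reduction {m} A e = Σ (Fin m → Cell m) λ A′ → SamePattern (A ∘ punchIn e) A′ × (Rainbow A′ → Rainbow A)

-- This undoes the index shift in `Prolongation`.
splitFin : (i j : Fin (suc n)) → i Fin.< j →
  Σ (Fin n × Fin n) λ (a , b) → inject₁ a ≡ i × suc b ≡ j × toℕ a ≤ toℕ b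
splitFin zero    (suc zero)    i<j = (zero , zero) , refl , refl , z≤n
splitFin zero    (suc (suc j)) i<j = (zero , suc j) , refl , refl , z≤n
splitFin {suc n} (suc i) (suc j) (s≤s i<j) with splitFin i j i<j
... | (a , b) , refl , refl , a≤b = (suc a , suc b) , refl , refl , s≤s a≤b

-- `A e` is placed on the diagonal and the other cells strictly above it. The prolongation gives
-- `A e` the new symbol `zero` and the others the shifted symbols of the smaller square. The cell
-- `A f` keeps the row of `A e` occupied after `A e` is removed, as `triangularWithDiagonal`
-- requires.
reduceRow : (A : Fin (suc (suc m)) → Cell (suc (suc m))) → Inj A → ∀ e f → e ≢ f →
  row A e ≡ row A f → Reduction A e
reduceRow {m} A A-inj e f e≢f same =
  A′ , pat , λ (L , latin , L-inj) → prolong L L-inj (Smetaniuk.prolongation L latin)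
  where
  B : Fin (suc m) → Cell (suc (suc m))
  B = A ∘ punchIn e
  S = tabulate B
  f∈S : (row A e , col A f) ∈ S
  f∈S = subst₂ (λ i k → (i , col A k) ∈ S) (trans (cong (row A) (punchIn-punchOut e≢f)) (sym same))
    (punchIn-punchOut e≢f) (∈-tabulate⁺ {f = B} (punchOut e≢f))
  e∉S : A e ∉ S
  e∉S p with ∈-tabulate⁻ p
  ... | k , eq = punchInᵢ≢i e k (sym (A-inj eq))
  tri = triangularWithDiagonal S (ℕ.≤-reflexive (length-tabulate B)) (row A e) (col A e) (col A f) f∈S e∉S
  t = proj₁ tri
  split : ∀ k → _
  split k = splitFin (ρ t (row B k)) (κ t (col B k)) (upper t (∈-tabulate⁺ {f = B} k))
  A′ : Fin (suc m) → Cell (suc m)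
  A′ = proj₁ ∘ split
  row-A′ : ∀ k → inject₁ (row A′ k) ≡ ρ t (row B k)
  row-A′ k = proj₁ (proj₂ (split k))
  col-A′ : ∀ k → suc (col A′ k) ≡ κ t (col B k)
  col-A′ k = proj₁ (proj₂ (proj₂ (split k)))
  pat : SamePattern B A′
  pat = record
    { row⁺ = λ {a} {b} eq → Fin.inject₁-injective (trans (row-A′ a) (trans (cong (ρ t) eq) (sym (row-A′ b))))
    ; row⁻ = λ {a} {b} eq → ρ-inj t (trans (sym (row-A′ a)) (trans (cong inject₁ eq) (row-A′ b)))
    ; col⁺ = λ {a} {b} eq → Fin.suc-injective (trans (col-A′ a) (trans (cong (κ t) eq) (sym (col-A′ b))))
    ; col⁻ = λ {a} {b} eq → κ-inj t (trans (sym (col-A′ a)) (trans (cong suc eq) (col-A′ b)))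
    }
  prolong : (L : Square (suc m)) → Inj (λ k → L (row A′ k) (col A′ k)) → Prolongation L → Rainbow A
  prolong L L-inj (K , (K-row , K-col) , K-diag , K-above) =
    (λ i j → K (ρ t i) (κ t j)) ,
    ((λ i eq → κ-inj t (K-row _ eq)) , (λ j eq → ρ-inj t (K-col _ eq))) ,
    inj
    where
    at-e : K (ρ t (row A e)) (κ t (col A e)) ≡ zero
    at-e = trans (cong (λ i → K i (κ t (col A e))) (proj₂ tri)) (K-diag _)
    at-B : ∀ k → K (ρ t (row B k)) (κ t (col B k)) ≡ suc (L (row A′ k) (col A′ k))
    at-B k = trans (cong₂ K (sym (row-A′ k)) (sym (col-A′ k)))
      (K-above _ _ (proj₂ (proj₂ (proj₂ (split k)))))
    inj : Inj (λ k → K (ρ t (row A k)) (κ t (col A k)))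
    inj {a} {b} eq with punchView e a | punchView e b
    ... | here    | here     = refl
    ... | here    | there b′ = contradiction (trans (sym at-e) (trans eq (at-B b′))) λ ()
    ... | there a′ | here    = contradiction (trans (sym (at-B a′)) (trans eq at-e)) λ ()
    ... | there a′ | there b′ = cong (punchIn e)
      (L-inj (Fin.suc-injective (trans (sym (at-B a′)) (trans eq (at-B b′)))))

reduce : (A : Fin (suc m) → Cell (suc m)) → Inj A → ∀ e f → e ≢ f → Adj A e f → Reduction A e
reduce {zero}  A A-inj zero zero e≢f _ = contradiction refl e≢f
reduce {suc m} A A-inj e f e≢f (inj₁ same) = reduceRow A A-inj e f e≢f same
reduce {suc m} A A-inj e f e≢f (inj₂ same)
  with reduceRow (swap ∘ A) (λ eq → A-inj (cong swap eq)) e f e≢f same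
... | A′ , p , r = swap ∘ A′ ,
  record { row⁺ = col⁺ p ; row⁻ = col⁻ p ; col⁺ = row⁺ p ; col⁻ = row⁻ p } ,
  (λ (L , (lr , lc) , inj) → transpose-rainbow A (r ((λ i j → L j i) , (lc , lr) , inj)))

-- Cells outside the core share a line with a core cell, so they can be removed one by one.
coreReduce : (A : Fin n → Cell n) → Inj A → (g : Fin k → Fin n) → Inj g →
  (∀ a → ∃[ t ] Adj A a (g t)) →
  (∀ B → SamePattern (A ∘ g) B → Rainbow {k} {k} B) → Rainbow A
coreReduce {n} {k} A A-inj g g-inj adj core with all? (λ a → any? (λ t → g t ≟ a))
... | yes onto = finish n≡k
  where
  n≡k : n ≡ k
  n≡k = ℕ.≤-antisym
    (Fin.injective⇒≤ {f = proj₁ ∘ onto} (λ {a} {b} eq →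
      trans (sym (proj₂ (onto a))) (trans (cong g eq) (proj₂ (onto b)))))
    (Fin.injective⇒≤ g-inj)
  finish : n ≡ k → Rainbow A
  finish refl with core (A ∘ g) (record { row⁺ = id ; row⁻ = id ; col⁺ = id ; col⁻ = id })
  ... | L , latin , inj = L , latin , λ {a} {b} eq → inj-A (onto a) (onto b) eq
    where
    inj-A : ∀ {a b} → ∃[ s ] g s ≡ a → ∃[ t ] g t ≡ b →
      L (row A a) (col A a) ≡ L (row A b) (col A b) → a ≡ b
    inj-A (s , refl) (t , refl) eq = cong g (inj eq)
... | no ¬onto = drop A A-inj g g-inj adj core
        (Fin.¬∀⟶∃¬ n (λ a → ∃[ t ] g t ≡ a) (λ a → any? (λ t → g t ≟ a)) ¬onto)
  where
  drop : ∀ {n} (A : Fin n → Cell n) → Inj A → (g : Fin k → Fin n) → Inj g →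
    (∀ a → ∃[ t ] Adj A a (g t)) →
    (∀ B → SamePattern (A ∘ g) B → Rainbow {k} {k} B) →
    (∃[ a ] ¬ (∃[ t ] g t ≡ a)) → Rainbow A
  drop {suc n} A A-inj g g-inj adj core (e , e∉g)
    with reduce A A-inj e (g (proj₁ (adj e))) (λ eq → e∉g (_ , sym eq)) (proj₂ (adj e))
  ... | A′ , pat , rainbow = rainbow (coreReduce A′ (pattern-inj pat (λ eq → Fin.punchIn-injective e _ _ (A-inj eq)))
          g′ g′-inj adj′ core′)
    where
    e≢g : ∀ t → e ≢ g t
    e≢g t eq = e∉g (t , sym eq)
    g′ : Fin k → Fin n
    g′ t = punchOut (e≢g t)
    p-g′ : ∀ t → punchIn e (g′ t) ≡ g t
    p-g′ t = punchIn-punchOut (e≢g t)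
    g′-inj : Inj g′
    g′-inj {s} {t} eq = g-inj (Fin.punchOut-injective (e≢g s) (e≢g t) eq)
    adj′ : ∀ a → ∃[ t ] Adj A′ a (g′ t)
    adj′ a with adj (punchIn e a)
    ... | t , inj₁ eq = t , inj₁ (row⁺ pat (trans eq (cong (row A) (sym (p-g′ t)))))
    ... | t , inj₂ eq = t , inj₂ (col⁺ pat (trans eq (cong (col A) (sym (p-g′ t)))))
    core′ : ∀ B → SamePattern (A′ ∘ g′) B → Rainbow B
    core′ B q = core B record
      { row⁺ = λ {s} {t} eq → row⁺ q (row⁺ pat (trans (cong (row A) (p-g′ s)) (trans eq (cong (row A) (sym (p-g′ t))))))
      ; row⁻ = λ {s} {t} eq → trans (cong (row A) (sym (p-g′ s))) (trans (row⁻ pat (row⁻ q eq)) (cong (row A) (p-g′ t)))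
      ; col⁺ = λ {s} {t} eq → col⁺ q (col⁺ pat (trans (cong (col A) (p-g′ s)) (trans eq (cong (col A) (sym (p-g′ t))))))
      ; col⁻ = λ {s} {t} eq → trans (cong (col A) (sym (p-g′ s))) (trans (col⁻ pat (col⁻ q eq)) (cong (col A) (p-g′ t)))
      }

-- Latin squares with a rainbow diagonal

%≡⇒∣∸ : ∀ x y p .{{_ : ℕ.NonZero p}} → x % p ≡ y % p → p ∣ y ∸ x
%≡⇒∣∸ x y p eq = divides (y / p ∸ x / p) (begin
  y ∸ x                                             ≡⟨ cong₂ _∸_ (m≡m%n+[m/n]*n y p) (m≡m%n+[m/n]*n x p) ⟩
  (y % p + y / p * p) ∸ (x % p + x / p * p)         ≡⟨ cong (λ r → (y % p + y / p * p) ∸ (r + x / p * p)) eq ⟩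
  (y % p + y / p * p) ∸ (y % p + x / p * p)         ≡⟨ ℕ.[m+n]∸[m+o]≡n∸o (y % p) _ _ ⟩
  y / p * p ∸ x / p * p                             ≡⟨ sym (ℕ.*-distribʳ-∸ p (y / p) (x / p)) ⟩
  (y / p ∸ x / p) * p                               ∎)
  where open ≡-Reasoning

∣∧<⇒≡0 : ∀ {d p} → p ∣ d → d ℕ.< p → d ≡ 0
∣∧<⇒≡0 {zero}  _   _   = refl
∣∧<⇒≡0 {suc d} p∣d d<p = contradiction p∣d (>⇒∤ d<p)

odd⇒coprime-2 : ∀ h → Coprime (suc (h + h)) 2
odd⇒coprime-2 h {d} (d∣p , d∣2) = ∣1⇒≡1
  (∣m+n∣m⇒∣n (subst (d ∣_) p≡ d∣p) (∣-trans d∣2 (m∣m*n h)))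
  where
  p≡ : suc (h + h) ≡ 2 * h + 1
  p≡ = trans (cong (λ x → suc (h + x)) (sym (ℕ.+-identityʳ h))) (ℕ.+-comm 1 (2 * h))

module Cyclic (p : ℕ) .{{_ : ℕ.NonZero p}} (p-odd : Coprime p 2) where

  double-∸ : ∀ a b → p ∣ (b + b) ∸ (a + a) → b ℕ.< p → b ∸ a ≡ 0
  double-∸ a b p∣ b<p = ∣∧<⇒≡0
    (coprime-divisor p-odd (subst (p ∣_) eq p∣)) (ℕ.≤-<-trans (ℕ.m∸n≤m b a) b<p)
    where
    eq : (b + b) ∸ (a + a) ≡ 2 * (b ∸ a)
    eq = trans (cong₂ (λ x y → (b + x) ∸ (a + y)) (sym (ℕ.+-identityʳ b)) (sym (ℕ.+-identityʳ a)))
               (sym (ℕ.*-distribˡ-∸ 2 b a))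

  cancelˡ : ∀ x {a b} → a ℕ.< p → b ℕ.< p → (x + a) % p ≡ (x + b) % p → a ≡ b
  cancelˡ x {a} {b} a<p b<p eq = ℕ.≤-antisym (half b a (sym eq) a<p) (half a b eq b<p)
    where
    half : ∀ a b → (x + a) % p ≡ (x + b) % p → b ℕ.< p → b ≤ a
    half a b eq b<p = ℕ.m∸n≡0⇒m≤n (∣∧<⇒≡0
      (subst (p ∣_) (ℕ.[m+n]∸[m+o]≡n∸o x b a) (%≡⇒∣∸ (x + a) (x + b) p eq))
      (ℕ.≤-<-trans (ℕ.m∸n≤m b a) b<p))

  cancel-double : ∀ {a b} → a ℕ.< p → b ℕ.< p → (a + a) % p ≡ (b + b) % p → a ≡ b
  cancel-double {a} {b} a<p b<p eq = ℕ.≤-antisym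
    (ℕ.m∸n≡0⇒m≤n (double-∸ b a (%≡⇒∣∸ (b + b) (a + a) p (sym eq)) a<p))
    (ℕ.m∸n≡0⇒m≤n (double-∸ a b (%≡⇒∣∸ (a + a) (b + b) p eq) b<p))

  -- The addition table of the cyclic group of order `p`. Its diagonal is rainbow because doubling
  -- is injective in odd order.
  Z : Square p
  Z i j = fromℕ< (m%n<n (toℕ i + toℕ j) p)

  toℕ-Z : ∀ i j → toℕ (Z i j) ≡ (toℕ i + toℕ j) % p
  toℕ-Z i j = Fin.toℕ-fromℕ< (m%n<n (toℕ i + toℕ j) p)

  Z-row : ∀ i → Inj (Z i)
  Z-row i {a} {b} eq = Fin.toℕ-injective (cancelˡ (toℕ i) (Fin.toℕ<n a) (Fin.toℕ<n b)
    (trans (sym (toℕ-Z i a)) (trans (cong toℕ eq) (toℕ-Z i b))))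

  Z-comm : ∀ i j → Z i j ≡ Z j i
  Z-comm i j = Fin.toℕ-injective (trans (toℕ-Z i j)
    (trans (cong (_% p) (ℕ.+-comm (toℕ i) (toℕ j))) (sym (toℕ-Z j i))))

  Z-col : ∀ j → Inj (λ i → Z i j)
  Z-col j {a} {b} eq = Z-row j (trans (Z-comm j a) (trans eq (Z-comm b j)))

  Z-latin : Latin Z
  Z-latin = Z-row , Z-col

  Z-diag : Inj (λ i → Z i i)
  Z-diag {a} {b} eq = Fin.toℕ-injective (cancel-double (Fin.toℕ<n a) (Fin.toℕ<n b)
    (trans (sym (toℕ-Z a a)) (trans (cong toℕ eq) (toℕ-Z b b))))

  Z-assoc : ∀ i j k → Z i (Z j k) ≡ Z (Z i j) k
  Z-assoc i j k = Fin.toℕ-injective (begin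
    toℕ (Z i (Z j k))                           ≡⟨ toℕ-Z i (Z j k) ⟩
    (toℕ i + toℕ (Z j k)) % p                   ≡⟨ cong (λ x → (toℕ i + x) % p) (toℕ-Z j k) ⟩
    (toℕ i + (toℕ j + toℕ k) % p) % p           ≡⟨ %-distribˡ-+ (toℕ i) _ p ⟩
    (toℕ i % p + (toℕ j + toℕ k) % p % p) % p   ≡⟨ cong (λ x → (toℕ i % p + x) % p) (m%n%n≡m%n (toℕ j + toℕ k) p) ⟩
    (toℕ i % p + (toℕ j + toℕ k) % p) % p       ≡⟨ sym (%-distribˡ-+ (toℕ i) _ p) ⟩
    (toℕ i + (toℕ j + toℕ k)) % p               ≡⟨ cong (_% p) (sym (ℕ.+-assoc (toℕ i) (toℕ j) (toℕ k))) ⟩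
    (toℕ i + toℕ j + toℕ k) % p                 ≡⟨ %-distribˡ-+ (toℕ i + toℕ j) _ p ⟩
    ((toℕ i + toℕ j) % p + toℕ k % p) % p       ≡⟨ cong (λ x → (x + toℕ k % p) % p) (sym (m%n%n≡m%n (toℕ i + toℕ j) p)) ⟩
    ((toℕ i + toℕ j) % p % p + toℕ k % p) % p   ≡⟨ sym (%-distribˡ-+ ((toℕ i + toℕ j) % p) _ p) ⟩
    ((toℕ i + toℕ j) % p + toℕ k) % p           ≡⟨ cong (λ x → (x + toℕ k) % p) (sym (toℕ-Z i j)) ⟩
    (toℕ (Z i j) + toℕ k) % p                   ≡⟨ sym (toℕ-Z (Z i j) k) ⟩
    toℕ (Z (Z i j) k)                           ∎)
    where open ≡-Reasoning

  Z-0 : ∀ i o → toℕ o ≡ 0 → Z i o ≡ i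
  Z-0 i o o≡0 = Fin.toℕ-injective (trans (toℕ-Z i o)
    (trans (cong (_% p) (trans (cong (toℕ i +_) o≡0) (ℕ.+-identityʳ (toℕ i)))) (m<n⇒m%n≡m (Fin.toℕ<n i))))

-- Replacing the transversal (i , τ i) by the new symbol 0 and moving its old
-- symbols into a new row leaves the diagonal untouched when τ has no fixed point.
addTransversal : (L : Square n) → Latin L → Inj (λ i → L i i) →
  (τ : Fin n → Fin n) → Inj τ → (∀ i → τ i ≢ i) → Inj (λ i → L i (τ i)) →
  ∃[ K ] Latin {suc n} K × Inj (λ i → K i i)
addTransversal {n} L (L-row , L-col) L-diag τ τ-inj τ≢ L-τ =
  K , K-latin , K-diag
  where
  σ : Fin n → Fin n
  σ j = proj₁ (inj⇒surj τ τ-inj j)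
  τσ : ∀ j → τ (σ j) ≡ j
  τσ j = proj₂ (inj⇒surj τ τ-inj j)

  X : Fin (suc n) → Fin n → Fin (suc n)
  X zero    j = suc (L (σ j) j)
  X (suc i) j with τ i ≟ j
  ... | yes _ = zero
  ... | no  _ = suc (L i j)

  X-row : ∀ i → Inj (X i)
  X-row zero {a} {b} eq = trans (sym (τσ a)) (trans (cong τ (L-τ
    (trans (cong (L (σ a)) (τσ a)) (trans (Fin.suc-injective eq) (cong (L (σ b)) (sym (τσ b))))))) (τσ b))
  X-row (suc i) {a} {b} eq with τ i ≟ a | τ i ≟ b
  ... | yes refl | yes refl = refl
  ... | no _     | no _     = L-row i (Fin.suc-injective eq)
  X-row (suc i) {a} {b} () | yes _ | no _
  X-row (suc i) {a} {b} () | no _  | yes _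

  σ≢ : ∀ i j → τ i ≢ j → L (σ j) j ≢ L i j
  σ≢ i j τi≢j eq = τi≢j (trans (cong τ (sym (L-col j eq))) (τσ j))

  X-col : ∀ j → Inj (λ i → X i j)
  X-col j {zero}  {zero}  _  = refl
  X-col j {zero}  {suc i} eq with τ i ≟ j
  X-col j {zero}  {suc i} () | yes _
  ... | no τi≢j = contradiction (Fin.suc-injective eq) (σ≢ i j τi≢j)
  X-col j {suc i} {zero}  eq with τ i ≟ j
  X-col j {suc i} {zero}  () | yes _
  ... | no τi≢j = contradiction (Fin.suc-injective (sym eq)) (σ≢ i j τi≢j)
  X-col j {suc i} {suc l} eq with τ i ≟ j | τ l ≟ j
  ... | yes τi≡j | yes τl≡j = cong suc (τ-inj (trans τi≡j (sym τl≡j)))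
  ... | no _     | no _     = cong suc (L-col j (Fin.suc-injective eq))
  X-col j {suc i} {suc l} () | yes _ | no _
  X-col j {suc i} {suc l} () | no _  | yes _

  ext = addColumn X X-row X-col
  K = proj₁ ext
  K-latin = proj₁ (proj₂ ext)
  K-X : ∀ i j → K i (suc j) ≡ X i j
  K-X = proj₂ (proj₂ ext)

  K-suc : ∀ i → K (suc i) (suc i) ≡ suc (L i i)
  K-suc i = trans (K-X (suc i) i) X-ii
    where
    X-ii : X (suc i) i ≡ suc (L i i)
    X-ii with τ i ≟ i
    ... | yes τi≡i = contradiction τi≡i (τ≢ i)
    ... | no _     = refl

  -- The transversal carries every symbol of `L`, so row `zero` already contains every `suc t`. The
  -- corner is left with `zero`, which occurs nowhere else on the diagonal.
  K-zero : ∀ t → K zero zero ≢ suc t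
  K-zero t eq with inj⇒surj (λ i → L i (τ i)) L-τ t
  ... | i , Li≡t = contradiction (proj₁ K-latin zero {zero} {suc (τ i)}
    (trans eq (trans (cong suc (trans (sym Li≡t) (cong (λ r → L r (τ i)) i≡σ))) (sym (K-X zero (τ i)))))) λ ()
    where
    i≡σ : i ≡ σ (τ i)
    i≡σ = τ-inj (sym (τσ (τ i)))

  K-diag : Inj (λ i → K i i)
  K-diag {zero}  {zero}  _  = refl
  K-diag {zero}  {suc b} eq = contradiction (trans eq (K-suc b)) (K-zero _)
  K-diag {suc a} {zero}  eq = contradiction (trans (sym eq) (K-suc a)) (K-zero _)
  K-diag {suc a} {suc b} eq = cong suc (L-diag (Fin.suc-injective (trans (sym (K-suc a)) (trans eq (K-suc b)))))

rainbowDiagonal-odd : ∀ h → ∃[ L ] Latin {suc (h + h)} L × Inj (λ i → L i i)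
rainbowDiagonal-odd h = Z , Z-latin , Z-diag
  where open Cyclic (suc (h + h)) (odd⇒coprime-2 h)

-- In the addition table of odd order the cells `(i , i + 1)` carry the symbols `2 i + 1`, so they
-- form a second rainbow transversal, disjoint from the diagonal. Starting from order at least 3
-- avoids order 2, where the diagonal of a Latin square is constant.
rainbowDiagonal-even : ∀ h → ∃[ L ] Latin {suc (suc (suc h + suc h))} L × Inj (λ i → L i i)
rainbowDiagonal-even h = addTransversal Z Z-latin Z-diag (λ i → Z i 1F) (Z-col 1F) shift≢ Z-shift
  where
  open Cyclic (suc (suc h + suc h)) (odd⇒coprime-2 (suc h))
  shift≢ : ∀ i → Z i 1F ≢ i
  shift≢ i eq = contradiction (Z-row i {1F} {0F} (trans eq (sym (Z-0 i 0F refl)))) λ ()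
  Z-shift : Inj (λ i → Z i (Z i 1F))
  Z-shift {a} {b} eq = Z-diag (Z-col 1F (trans (sym (Z-assoc a a 1F)) (trans eq (Z-assoc b b 1F))))

parity : ∀ n → ∃[ h ] (n ≡ h + h ⊎ n ≡ suc (h + h))
parity zero    = 0 , inj₁ refl
parity (suc n) with parity n
... | h , inj₁ refl = h , inj₂ refl
... | h , inj₂ refl = suc h , inj₁ (cong suc (sym (ℕ.+-suc h h)))

rainbowDiagonal : 3 ≤ n → ∃[ L ] Latin {n} L × Inj (λ i → L i i)
rainbowDiagonal {n} 3≤n with parity n
... | h , inj₂ refl = rainbowDiagonal-odd h
... | suc (suc h) , inj₁ refl = subst (λ n → ∃[ L ] Latin {n} L × Inj (λ i → L i i))
  (cong suc (sym (ℕ.+-suc (suc h) (suc h)))) (rainbowDiagonal-even h)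
rainbowDiagonal {.0} () | zero , inj₁ refl
rainbowDiagonal {.2} (s≤s (s≤s ())) | suc zero , inj₁ refl

-- Rainbow core configurations

inverse : (f : Fin n → Fin n) → Inj f → Σ (Fin n → Fin n) λ g → Inj g × (∀ i → g (f i) ≡ i)
inverse f f-inj = g , (λ {x} {y} eq → trans (sym (fg x)) (trans (cong f eq) (fg y))) , λ i → f-inj (fg (f i))
  where
  g = λ y → proj₁ (inj⇒surj f f-inj y)
  fg : ∀ y → f (g y) ≡ y
  fg y = proj₂ (inj⇒surj f f-inj y)

relabel : (L : Square n) → Latin L → (ρ κ : Fin n → Fin n) → Inj ρ → Inj κ → Latin (λ i j → L (ρ i) (κ j))
relabel L (L-row , L-col) ρ κ ρ-inj κ-inj =
  (λ i eq → κ-inj (L-row _ eq)) , (λ j eq → ρ-inj (L-col _ eq))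

rainbow-transversal : 3 ≤ n → (A : Fin n → Cell n) → Inj (row A) → Inj (col A) → Rainbow A
rainbow-transversal 3≤n A r-inj c-inj
  with rainbowDiagonal 3≤n | inverse (row A) r-inj | inverse (col A) c-inj
... | L , latin , diag | ρ , ρ-inj , ρ-row | κ , κ-inj , κ-col =
  _ , relabel L latin ρ κ ρ-inj κ-inj ,
  λ {a} {b} eq → diag (trans (sym (cong₂ L (ρ-row a) (κ-col a))) (trans eq (cong₂ L (ρ-row b) (κ-col b))))

rainbow-2 : (A : Fin 2 → Cell 2) → Inj A → Adj A zero (suc zero) → Rainbow A
rainbow-2 A A-inj adj = L , (L-row , L-col) , inj
  where
  L : Square 2
  L zero       j          = j
  L (suc zero) zero       = suc zero
  L (suc zero) (suc zero) = zero
  L-row : ∀ i → Inj (L i)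
  L-row i {a} {b} = from-yes (all? λ i → all? λ a → all? λ b → (L i a ≟ L i b) →-dec (a ≟ b)) i a b
  L-col : ∀ j → Inj (λ i → L i j)
  L-col j {a} {b} = from-yes (all? λ j → all? λ a → all? λ b → (L a j ≟ L b j) →-dec (a ≟ b)) j a b
  differ : Adj A zero (suc zero) → L (row A zero) (col A zero) ≢ L (row A (suc zero)) (col A (suc zero))
  differ (inj₁ r) eq = contradiction
    (A-inj (cong₂ _,_ r (L-row _ (trans eq (cong (λ i → L i (col A 1F)) (sym r)))))) λ ()
  differ (inj₂ c) eq = contradiction
    (A-inj (cong₂ _,_ (L-col _ (trans eq (cong (L (row A 1F)) (sym c)))) c)) λ ()
  inj : Inj (λ k → L (row A k) (col A k))
  inj {zero}     {zero}     _  = refl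
  inj {zero}     {suc zero} eq = contradiction eq (differ adj)
  inj {suc zero} {zero}     eq = contradiction (sym eq) (differ adj)
  inj {suc zero} {suc zero} _  = refl

-- The Cayley table of the Klein four-group. Row 1 permutes the symbols of row 0 within columns 0, 1
-- and within columns 2, 3, so the left half of row 0 and the right half of row 1 together carry all
-- four symbols. In the cyclic table of order 4 the symbol 0 would occur twice there.
klein : Square 4
klein 0F j  = j
klein 1F 0F = 1F
klein 1F 1F = 0F
klein 1F 2F = 3F
klein 1F 3F = 2F
klein 2F 0F = 2F
klein 2F 1F = 3F
klein 2F 2F = 0F
klein 2F 3F = 1F
klein 3F 0F = 3F
klein 3F 1F = 2F
klein 3F 2F = 1F
klein 3F 3F = 0F

klein-latin : Latin klein
klein-latin = (λ i {a} {b} → from-yes (all? λ i → all? λ a → all? λ b → (klein i a ≟ klein i b) →-dec (a ≟ b)) i a b) ,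
              (λ j {a} {b} → from-yes (all? λ j → all? λ a → all? λ b → (klein a j ≟ klein b j) →-dec (a ≟ b)) j a b)

rainbow-4 : (A : Fin 4 → Cell 4) → row A 0F ≡ row A 1F → row A 2F ≡ row A 3F →
  row A 0F ≢ row A 2F → Inj (col A) → Rainbow A
rainbow-4 A r₀₁ r₂₃ r₀₂ c-inj with inverse (col A) c-inj
... | κ , κ-inj , κ-col = _ , relabel klein klein-latin π κ π-inj κ-inj , inj
  where
  π : Fin 4 → Fin 4
  π = toFront (row A 0F) (toFront (punchOut r₀₂) id)
  π-inj : Inj π
  π-inj = toFront-inj (row A 0F) (toFront-inj (punchOut r₀₂) id)
  π0 : π (row A 0F) ≡ 0F
  π0 = toFront-here (row A 0F) (toFront (punchOut r₀₂) id)
  π2 : π (row A 2F) ≡ 1F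
  π2 = trans (cong π (sym (punchIn-punchOut r₀₂)))
    (trans (toFront-there (row A 0F) _ (punchOut r₀₂)) (cong suc (toFront-here (punchOut r₀₂) id)))
  half : Fin 4 → Fin 4
  half 0F = 0F
  half 1F = 0F
  half 2F = 1F
  half 3F = 1F
  π-row : ∀ k → π (row A k) ≡ half k
  π-row 0F = π0
  π-row 1F = trans (cong π (sym r₀₁)) π0
  π-row 2F = π2
  π-row 3F = trans (cong π (sym r₂₃)) π2
  inj : Inj (λ k → klein (π (row A k)) (κ (col A k)))
  inj {a} {b} eq = from-yes (all? λ a → all? λ b → (klein (half a) a ≟ klein (half b) b) →-dec (a ≟ b)) a b
    (trans (sym (cong₂ klein (π-row a) (κ-col a))) (trans eq (cong₂ klein (π-row b) (κ-col b))))

-- Every proper family of n ≥ 7 cells is rainbow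

adj? : (A : Fin k → Cell n) → ∀ a b → Dec (Adj A a b)
adj? A a b = (row A a ≟ row A b) ⊎-dec (col A a ≟ col A b)

adj-sym : (A : Fin k → Cell n) → ∀ {a b} → Adj A a b → Adj A b a
adj-sym A = Sum.map sym sym

Matching : (Fin n → Cell m) → (Fin k → Fin n) → Set
Matching A g = ∀ {s t} → Adj A (g s) (g t) → s ≡ t

matching-inj : (A : Fin n → Cell m) (g : Fin k → Fin n) → Matching A g → Inj g
matching-inj A g match eq = match (inj₁ (cong (row A) eq))

matching-∷ : (A : Fin n → Cell m) (g : Fin k → Fin n) → Matching A g →
  ∀ a → (∀ t → ¬ Adj A a (g t)) → Matching A (a Vector.∷ g)
matching-∷ A g match a ¬adj {zero}  {zero}  _   = refl
matching-∷ A g match a ¬adj {zero}  {suc t} adj = contradiction adj (¬adj t)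
matching-∷ A g match a ¬adj {suc s} {zero}  adj = contradiction (adj-sym A adj) (¬adj s)
matching-∷ A g match a ¬adj {suc s} {suc t} adj = cong suc (match adj)

-- A maximal matching containing g is a core.
rainbow-matching : (A : Fin n → Cell n) → Inj A → (g : Fin k → Fin n) → Matching A g → 3 ≤ k → Rainbow A
rainbow-matching {n} A A-inj g match 3≤k = extend n g match 3≤k (ℕ.m≤m+n n _)
  where
  -- `fuel` bounds the number of cells still to be added: a matching is injective, so it has at most
  -- `n` cells.
  extend : ∀ {k} fuel (g : Fin k → Fin n) → Matching A g → 3 ≤ k → n ≤ fuel + k → Rainbow A
  extend fuel g match 3≤k n≤ with any? (λ a → all? (λ t → ¬? (adj? A a (g t))))
  ... | no ¬∃ = coreReduce A A-inj g (matching-inj A g match) adj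
    (λ B p → rainbow-transversal 3≤k B (λ eq → match (inj₁ (row⁻ p eq))) (λ eq → match (inj₂ (col⁻ p eq))))
    where
    adj : ∀ a → ∃[ t ] Adj A a (g t)
    adj a = decidable-stable (any? (λ t → adj? A a (g t))) (λ ¬adj → ¬∃ (a , λ t x → ¬adj (t , x)))
  extend zero       g match 3≤k n≤ | yes (a , ¬adj) = contradiction
    (Fin.injective⇒≤ (matching-inj A (a Vector.∷ g) (matching-∷ A g match a ¬adj))) (ℕ.<⇒≱ (s≤s n≤))
  extend (suc fuel) g match 3≤k n≤ | yes (a , ¬adj) =
    extend fuel (a Vector.∷ g) (matching-∷ A g match a ¬adj) (ℕ.m≤n⇒m≤1+n 3≤k)
      (ℕ.≤-trans n≤ (ℕ.≤-reflexive (sym (ℕ.+-suc fuel _))))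

Triple : (Fin k → Cell n) → Set
Triple A = ∃[ a ] ∃[ b ] ∃[ c ] ¬ Adj A a b × ¬ Adj A a c × ¬ Adj A b c

triple? : (A : Fin k → Cell n) → Dec (Triple A)
triple? A = any? λ a → any? λ b → any? λ c →
  ¬? (adj? A a b) ×-dec ¬? (adj? A a c) ×-dec ¬? (adj? A b c)

rainbow-triple : (A : Fin n → Cell n) → Inj A → Triple A → Rainbow A
rainbow-triple {n} A A-inj (a , b , c , ab , ac , bc) = rainbow-matching A A-inj g match ℕ.≤-refl
  where
  g : Fin 3 → Fin n
  g 0F = a
  g 1F = b
  g 2F = c
  match : Matching A g
  match {0F} {0F} _ = refl
  match {0F} {1F} x = contradiction x ab
  match {0F} {2F} x = contradiction x ac
  match {1F} {0F} x = contradiction (adj-sym A x) ab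
  match {1F} {1F} _ = refl
  match {1F} {2F} x = contradiction x bc
  match {2F} {0F} x = contradiction (adj-sym A x) ac
  match {2F} {1F} x = contradiction (adj-sym A x) bc
  match {2F} {2F} _ = refl

-- The core consists of `f` and `g`. They must share a line, since two cells in general position in
-- order 2 always carry the same symbol.
rainbow-dominated : (A : Fin n → Cell n) → Inj A → ∀ f g → f ≢ g → Adj A f g →
  (∀ a → Adj A a f ⊎ Adj A a g) → Rainbow A
rainbow-dominated {n} A A-inj f g f≢g f~g dom = coreReduce A A-inj h h-inj adj core
  where
  h : Fin 2 → Fin n
  h 0F = f
  h 1F = g
  h-inj : Inj h
  h-inj {0F} {0F} _  = refl
  h-inj {0F} {1F} eq = contradiction eq f≢g
  h-inj {1F} {0F} eq = contradiction (sym eq) f≢g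
  h-inj {1F} {1F} _  = refl
  adj : ∀ a → ∃[ t ] Adj A a (h t)
  adj a = [ (0F ,_) , (1F ,_) ]′ (dom a)
  core : ∀ B → SamePattern (A ∘ h) B → Rainbow B
  core B p = rainbow-2 B (pattern-inj p (λ eq → h-inj (A-inj eq))) (Sum.map (row⁺ p) (col⁺ p) f~g)

-- If some column contains a cell of each row, these two cells share that column and dominate the
-- family. Otherwise all columns are distinct, and two cells from each row form a core for the Klein
-- square.
rainbow-twoRows : (A : Fin n → Cell n) → Inj A → ∀ a b c d → a ≢ b → c ≢ d →
  row A a ≡ row A b → row A c ≡ row A d → row A a ≢ row A c →
  (∀ z → row A z ≡ row A a ⊎ row A z ≡ row A c) → Rainbow A
rainbow-twoRows {n} A A-inj a b c d a≢b c≢d ab cd a≢c two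
  with any? (λ p → any? (λ q → (row A p ≟ row A a) ×-dec (row A q ≟ row A c) ×-dec (col A p ≟ col A q)))
... | yes (p , q , pa , qc , pq) = rainbow-dominated A A-inj p q
  (λ eq → a≢c (trans (sym pa) (trans (cong (row A) eq) qc))) (inj₂ pq)
  (λ z → Sum.map (λ za → inj₁ (trans za (sym pa))) (λ zc → inj₁ (trans zc (sym qc))) (two z))
... | no ¬∃ = coreReduce A A-inj h h-inj adj core
  where
  col-inj : Inj (col A)
  col-inj {y} {z} eq with two y | two z
  ... | inj₁ ya | inj₁ za = A-inj (cong₂ _,_ (trans ya (sym za)) eq)
  ... | inj₁ ya | inj₂ zc = contradiction (y , z , ya , zc , eq) ¬∃
  ... | inj₂ yc | inj₁ za = contradiction (z , y , za , yc , sym eq) ¬∃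
  ... | inj₂ yc | inj₂ zc = A-inj (cong₂ _,_ (trans yc (sym zc)) eq)
  h : Fin 4 → Fin n
  h 0F = a
  h 1F = b
  h 2F = c
  h 3F = d
  apart : ∀ {x y} → row A x ≡ row A a → row A y ≡ row A c → x ≢ y
  apart xa yc eq = a≢c (trans (sym xa) (trans (cong (row A) eq) yc))
  h-inj : Inj h
  h-inj {0F} {0F} _  = refl
  h-inj {0F} {1F} eq = contradiction eq a≢b
  h-inj {0F} {2F} eq = contradiction eq (apart refl refl)
  h-inj {0F} {3F} eq = contradiction eq (apart refl (sym cd))
  h-inj {1F} {0F} eq = contradiction (sym eq) a≢b
  h-inj {1F} {1F} _  = refl
  h-inj {1F} {2F} eq = contradiction eq (apart (sym ab) refl)
  h-inj {1F} {3F} eq = contradiction eq (apart (sym ab) (sym cd))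
  h-inj {2F} {0F} eq = contradiction (sym eq) (apart refl refl)
  h-inj {2F} {1F} eq = contradiction (sym eq) (apart (sym ab) refl)
  h-inj {2F} {2F} _  = refl
  h-inj {2F} {3F} eq = contradiction eq c≢d
  h-inj {3F} {0F} eq = contradiction (sym eq) (apart refl (sym cd))
  h-inj {3F} {1F} eq = contradiction (sym eq) (apart (sym ab) (sym cd))
  h-inj {3F} {2F} eq = contradiction (sym eq) c≢d
  h-inj {3F} {3F} _  = refl
  adj : ∀ z → ∃[ t ] Adj A z (h t)
  adj z = [ (λ za → 0F , inj₁ za) , (λ zc → 2F , inj₁ zc) ]′ (two z)
  core : ∀ B → SamePattern (A ∘ h) B → Rainbow B
  core B p = rainbow-4 B (row⁺ p ab) (row⁺ p cd) (λ eq → a≢c (row⁻ p eq))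
    (λ eq → h-inj (col-inj (col⁻ p eq)))

¬triple-adj : (A : Fin k → Cell n) → ¬ Triple A → ∀ a b c → ¬ Adj A a b → ¬ Adj A a c → Adj A b c
¬triple-adj A ¬T a b c ab ac = decidable-stable (adj? A b c) (λ bc → ¬T (a , b , c , ab , ac , bc))

-- Two cells outside the row that share no line would form a triple with one
-- of the three cells in the row.
rainbow-heavyRow : (A : Fin n → Cell n) → Inj A → Proper A → ¬ Triple A →
  ∀ a b c → a ≢ b → a ≢ c → b ≢ c → row A a ≡ row A b → row A a ≡ row A c → Rainbow A
rainbow-heavyRow {n} A A-inj proper ¬T a b c a≢b a≢c b≢c ab ac
  with any? (λ k → ¬? (row A k ≟ row A a))
... | no ¬∃ = rainbow-dominated A A-inj a b a≢b (inj₁ ab)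
  (λ z → inj₁ (inj₁ (decidable-stable (row A z ≟ row A a) (λ z≢a → ¬∃ (z , z≢a)))))
... | yes (k , k∉) with any? (λ l → ¬? (row A l ≟ row A a) ×-dec ¬? (col A l ≟ col A k))
...   | no ¬∃ = cross (any? (λ p → (row A p ≟ row A a) ×-dec (col A p ≟ col A k)))
  where
  covered : ∀ z → row A z ≡ row A a ⊎ col A z ≡ col A k
  covered z = decidable-stable ((row A z ≟ row A a) ⊎-dec (col A z ≟ col A k))
    (λ ¬cov → ¬∃ (z , ¬cov ∘ inj₁ , ¬cov ∘ inj₂))
  -- All cells lie in a cross. If its corner belongs to the family, the corner and `k` share a
  -- column and dominate everything; if not, the family is improper.
  cross : Dec (∃[ p ] row A p ≡ row A a × col A p ≡ col A k) → Rainbow A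
  cross (yes (p , pa , pk)) = rainbow-dominated A A-inj p k
    (λ eq → k∉ (trans (cong (row A) (sym eq)) pa)) (inj₂ pk)
    (λ z → Sum.map (λ za → inj₁ (trans za (sym pa))) inj₂ (covered z))
  cross (no ¬p) = contradiction
    (row A a , col A k , λ z → covered z , λ eq → ¬p (z , cong proj₁ eq , cong proj₂ eq)) proper
...   | yes (l , l∉ , l≢k) = rainbow-twoRows A A-inj a b k l a≢b (λ eq → l≢k (cong (col A) (sym eq))) ab
  (sameRow k l k∉ l∉ (≢-sym l≢k)) (≢-sym k∉) two
  where
  col≢ : ∀ {x y} → x ≢ y → row A x ≡ row A y → col A x ≢ col A y
  col≢ x≢y r c = x≢y (A-inj (cong₂ _,_ r c))
  avoid : ∀ j j′ → ∃[ x ] row A x ≡ row A a × col A x ≢ j × col A x ≢ j′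
  avoid j j′ with col A a ≟ j | col A a ≟ j′ | col A b ≟ j | col A b ≟ j′
  ... | no p     | no q     | _        | _        = a , refl , p , q
  ... | _        | _        | no p     | no q     = b , sym ab , p , q
  ... | yes p    | _        | yes q    | _        = contradiction (trans p (sym q)) (col≢ a≢b ab)
  ... | _        | yes p    | _        | yes q    = contradiction (trans p (sym q)) (col≢ a≢b ab)
  ... | yes p    | _        | _        | yes q    = c , sym ac ,
    (λ e → col≢ a≢c ac (trans p (sym e))) , (λ e → col≢ b≢c (trans (sym ab) ac) (trans q (sym e)))
  ... | _        | yes p    | yes q    | _        = c , sym ac ,
    (λ e → col≢ b≢c (trans (sym ab) ac) (trans q (sym e))) , (λ e → col≢ a≢c ac (trans p (sym e)))
  outside : ∀ p q → row A p ≢ row A a → row A q ≢ row A a → Adj A p q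
  outside p q p∉ q∉ with avoid (col A p) (col A q)
  ... | x , xa , x≢p , x≢q = ¬triple-adj A ¬T x p q
    [ (λ e → p∉ (trans (sym e) xa)) , x≢p ]′ [ (λ e → q∉ (trans (sym e) xa)) , x≢q ]′
  sameRow : ∀ p q → row A p ≢ row A a → row A q ≢ row A a → col A p ≢ col A q → row A p ≡ row A q
  sameRow p q p∉ q∉ p≢q = [ id , (λ e → contradiction e p≢q) ]′ (outside p q p∉ q∉)
  -- Outside the heavy row, cells in different columns lie in one row. A cell in the column of `k`
  -- is therefore compared with `l`, which lies in another column.
  two : ∀ z → row A z ≡ row A a ⊎ row A z ≡ row A k
  two z with row A z ≟ row A a | col A z ≟ col A k
  ... | yes za | _      = inj₁ za
  ... | no z∉  | no z≢k = inj₂ (sameRow z k z∉ k∉ z≢k)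
  ... | no z∉  | yes zk = inj₂ (trans (sameRow z l z∉ l∉ (λ zl → l≢k (trans (sym zl) zk)))
                                (sym (sameRow k l k∉ l∉ (≢-sym l≢k))))

rainbow-heavyCol : (A : Fin n → Cell n) → Inj A → Proper A → ¬ Triple A →
  ∀ a b c → a ≢ b → a ≢ c → b ≢ c → col A a ≡ col A b → col A a ≡ col A c → Rainbow A
rainbow-heavyCol A A-inj proper ¬T a b c a≢b a≢c b≢c ab ac = transpose-rainbow A
  (rainbow-heavyRow (swap ∘ A) (λ eq → A-inj (cong swap eq))
    (λ (i , j , imp) → proper (j , i , λ k → Sum.swap (proj₁ (imp k)) , λ eq → proj₂ (imp k) (cong swap eq)))
    (λ (x , y , z , xy , xz , yz) → ¬T (x , y , z , xy ∘ Sum.swap , xz ∘ Sum.swap , yz ∘ Sum.swap))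
    a b c a≢b a≢c b≢c ab ac)

-- Without a triple, every cell lies on one of the four lines through two cells `f` and `g` in
-- general position. At least five cells remain besides these two, so two of them are on the same
-- line, and with `f` or `g` they make it heavy. If no such `f` and `g` exist, any two cells
-- dominate.
rainbow-proper : 7 ≤ n → (A : Fin n → Cell n) → Inj A → Proper A → Rainbow A
rainbow-proper {suc (suc n)} (s≤s (s≤s 5≤n)) A A-inj proper with triple? A
... | yes T = rainbow-triple A A-inj T
... | no ¬T with any? (λ f → any? (λ g → ¬? (adj? A f g)))
...   | no ¬∃ = rainbow-dominated A A-inj 0F 1F (λ ()) (all-adj 0F 1F) (λ a → inj₁ (all-adj a 0F))
  where
  all-adj : ∀ f g → Adj A f g
  all-adj f g = decidable-stable (adj? A f g) (λ ¬adj → ¬∃ (f , g , ¬adj))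
...   | yes (f , g , ¬fg) = heavy (Fin.pigeonhole 5≤n (proj₁ ∘ line ∘ rest))
  where
  f≢g : f ≢ g
  f≢g eq = ¬fg (inj₁ (cong (row A) eq))
  g′ = punchOut f≢g
  rest : Fin n → Fin (suc (suc n))
  rest = punchIn f ∘ punchIn g′
  rest≢f : ∀ x → rest x ≢ f
  rest≢f x = punchInᵢ≢i f (punchIn g′ x)
  rest≢g : ∀ x → rest x ≢ g
  rest≢g x eq = punchInᵢ≢i g′ x (Fin.punchIn-injective f _ _ (trans eq (sym (punchIn-punchOut f≢g))))
  OnLine : Fin 4 → Fin (suc (suc n)) → Set
  OnLine 0F a = row A f ≡ row A a
  OnLine 1F a = col A f ≡ col A a
  OnLine 2F a = row A g ≡ row A a
  OnLine 3F a = col A g ≡ col A a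
  line : ∀ a → ∃[ c ] OnLine c a
  line a with adj? A f a
  ... | yes (inj₁ r) = 0F , r
  ... | yes (inj₂ c) = 1F , c
  ... | no ¬fa with ¬triple-adj A ¬T f g a ¬fg ¬fa
  ...   | inj₁ r = 2F , r
  ...   | inj₂ c = 3F , c
  heavyLine : ∀ c a b → a ≢ b → a ≢ f → a ≢ g → b ≢ f → b ≢ g → OnLine c a → OnLine c b → Rainbow A
  heavyLine 0F a b ab af ag bf bg = rainbow-heavyRow A A-inj proper ¬T f a b (≢-sym af) (≢-sym bf) ab
  heavyLine 1F a b ab af ag bf bg = rainbow-heavyCol A A-inj proper ¬T f a b (≢-sym af) (≢-sym bf) ab
  heavyLine 2F a b ab af ag bf bg = rainbow-heavyRow A A-inj proper ¬T g a b (≢-sym ag) (≢-sym bg) ab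
  heavyLine 3F a b ab af ag bf bg = rainbow-heavyCol A A-inj proper ¬T g a b (≢-sym ag) (≢-sym bg) ab
  heavy : (∃[ x ] ∃[ y ] x Fin.< y × proj₁ (line (rest x)) ≡ proj₁ (line (rest y))) → Rainbow A
  heavy (x , y , x<y , eq) = heavyLine _ (rest x) (rest y)
    (λ e → Fin.<⇒≢ x<y (Fin.punchIn-injective g′ _ _ (Fin.punchIn-injective f _ _ e)))
    (rest≢f x) (rest≢g x) (rest≢f y) (rest≢g y)
    (proj₂ (line (rest x))) (subst (λ c → OnLine c (rest y)) (sym eq) (proj₂ (line (rest y))))

-- Colours

_≟c_ : (c d : Colour) → Dec (c ≡ d)
red  ≟c red  = yes refl
red  ≟c blue = no λ ()
blue ≟c red  = no λ ()
blue ≟c blue = yes refl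

≢-unique : ∀ {c d e : Colour} → d ≢ c → e ≢ c → d ≡ e
≢-unique {red}  {red}  {_}    d≢c _   = contradiction refl d≢c
≢-unique {red}  {blue} {red}  _   e≢c = contradiction refl e≢c
≢-unique {red}  {blue} {blue} _   _   = refl
≢-unique {blue} {blue} {_}    d≢c _   = contradiction refl d≢c
≢-unique {blue} {red}  {red}  _   _   = refl
≢-unique {blue} {red}  {blue} _   e≢c = contradiction refl e≢c

Balancing : Array n → Square n → Set
Balancing M L = ∀ s c → ∃[ i ] ∃[ j ] L i j ≡ s × M (i , j) ≡ c

latin⇒partition : (M : Array n) (L : Square n) → Latin L → Balancing M L → BalancedPartition M
latin⇒partition {n} M L (L-row , L-col) bal = D , balanced , partition
  where
  colOf : ∀ s i → ∃[ j ] L i j ≡ s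
  colOf s i = inj⇒surj (L i) (L-row i) s
  rowOf : ∀ s j → ∃[ i ] L i j ≡ s
  rowOf s j = inj⇒surj (λ i → L i j) (L-col j) s
  D : Fin n → Diagonal n
  D s = permutation (proj₁ ∘ colOf s) (proj₁ ∘ rowOf s)
    (λ j → L-row _ (trans (proj₂ (colOf s (proj₁ (rowOf s j)))) (sym (proj₂ (rowOf s j)))))
    (λ i → L-col _ (trans (proj₂ (rowOf s (proj₁ (colOf s i)))) (sym (proj₂ (colOf s i)))))
  balanced : ∀ s → Balanced M (D s)
  balanced s c with bal s c
  ... | i , j , Lij≡s , Mij≡c = i ,
    trans (cong (λ j → M (i , j)) (L-row i (trans (proj₂ (colOf s i)) (sym Lij≡s)))) Mij≡c
  partition : ∀ x → ∃[ s ] (x ∈D D s × (∀ s′ → x ∈D D s′ → s′ ≡ s))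
  partition (i , j) = L i j , L-row i (proj₂ (colOf (L i j) i)) ,
    λ s x∈ → trans (sym (proj₂ (colOf s i))) (cong (L i) x∈)

-- There are as many cells in `R` as symbols, so a rainbow `R` meets every symbol and supplies the
-- colour `c`.
rainbow⇒balancing : (M : Array n) (c : Colour) (R : Fin n → Cell n) → (∀ k → M (R k) ≡ c) →
  (L : Square n) → Inj (λ k → L (row R k) (col R k)) →
  (∀ s → ∃[ i ] ∃[ j ] L i j ≡ s × M (i , j) ≢ c) → Balancing M L
rainbow⇒balancing M c R mono L inj other s d with d ≟c c
... | yes refl = let k , eq = inj⇒surj _ inj s in row R k , col R k , eq , mono k
... | no d≢c   = let i , j , eq , ≢c = other s in i , j , eq , ≢-unique ≢c d≢c

-- A symbol whose cells in rows u and v both had colour c would occur twice on R.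
twoRows⇒other : (M : Array n) (c : Colour) (R : Fin n → Cell n) (L : Square n) → Latin L →
  Inj (λ k → L (row R k) (col R k)) → ∀ u v → u ≢ v →
  (∀ j → M (u , j) ≡ c → ∃[ k ] R k ≡ (u , j)) →
  (∀ j → M (v , j) ≡ c → ∃[ k ] R k ≡ (v , j)) →
  ∀ s → ∃[ i ] ∃[ j ] L i j ≡ s × M (i , j) ≢ c
twoRows⇒other M c R L (L-row , _) inj u v u≢v coverᵤ coverᵥ s
  with inj⇒surj (L u) (L-row u) s | inj⇒surj (L v) (L-row v) s
... | j , Luj | l , Lvl with M (u , j) ≟c c | M (v , l) ≟c c
...   | no ≢c | _     = u , j , Luj , ≢c
...   | _     | no ≢c = v , l , Lvl , ≢c
...   | yes p | yes q with coverᵤ j p | coverᵥ l q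
...     | a , Ra | b , Rb = contradiction (trans (sym (cong proj₁ Ra)) (trans (cong (row R) a≡b) (cong proj₁ Rb))) u≢v
  where
  at : ∀ {k i j} → R k ≡ (i , j) → L (row R k) (col R k) ≡ L i j
  at eq = cong₂ L (cong proj₁ eq) (cong proj₂ eq)
  a≡b : a ≡ b
  a≡b = inj (trans (at Ra) (trans Luj (sym (trans (at Rb) Lvl))))

Share : Cell n → Cell n → Set
Share x y = proj₁ x ≡ proj₁ y ⊎ proj₂ x ≡ proj₂ y

MonoTriple : Array n → Colour → Set
MonoTriple M c = ∃[ x ] ∃[ y ] ∃[ z ] (M x ≡ c × M y ≡ c × M z ≡ c) ×
  ¬ Share x y × ¬ Share x z × ¬ Share y z

anyCell? : {P : Cell n → Set} → Decidable P → Dec (∃ P)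
anyCell? P? = map′ (λ (i , j , p) → (i , j) , p) (λ ((i , j) , p) → i , j , p)
  (any? λ i → any? λ j → P? (i , j))

share? : (x y : Cell n) → Dec (Share x y)
share? x y = (proj₁ x ≟ proj₁ y) ⊎-dec (proj₂ x ≟ proj₂ y)

monoTriple? : (M : Array n) (c : Colour) → Dec (MonoTriple M c)
monoTriple? M c = anyCell? λ x → anyCell? λ y → anyCell? λ z →
  ((M x ≟c c) ×-dec (M y ≟c c) ×-dec (M z ≟c c)) ×-dec
  ¬? (share? x y) ×-dec ¬? (share? x z) ×-dec ¬? (share? y z)

-- The cells of a symbol in three rows are in general position, so they cannot all have colour `c`.
¬triple⇒other : (M : Array (3 + n)) (c : Colour) → ¬ MonoTriple M c → (L : Square (3 + n)) → Latin L →
  ∀ s → ∃[ i ] ∃[ j ] L i j ≡ s × M (i , j) ≢ c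
¬triple⇒other {n} M c ¬T L (L-row , L-col) s = search (M (x 0F) ≟c c) (M (x 1F) ≟c c) (M (x 2F) ≟c c)
  where
  colOf : ∀ i → ∃[ j ] L i j ≡ s
  colOf i = inj⇒surj (L i) (L-row i) s
  x : Fin (3 + n) → Cell (3 + n)
  x i = i , proj₁ (colOf i)
  apart : ∀ i j → i ≢ j → ¬ Share (x i) (x j)
  apart i j i≢j (inj₁ eq) = i≢j eq
  apart i j i≢j (inj₂ eq) = i≢j (L-col _
    (trans (cong (L i) (sym eq)) (trans (proj₂ (colOf i)) (sym (proj₂ (colOf j))))))
  search : Dec (M (x 0F) ≡ c) → Dec (M (x 1F) ≡ c) → Dec (M (x 2F) ≡ c) → _
  search (no ≢c) _       _       = 0F , _ , proj₂ (colOf 0F) , ≢c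
  search (yes _) (no ≢c) _       = 1F , _ , proj₂ (colOf 1F) , ≢c
  search (yes _) (yes _) (no ≢c) = 2F , _ , proj₂ (colOf 2F) , ≢c
  search (yes p) (yes q) (yes r) = contradiction
    (x 0F , x 1F , x 2F , (p , q , r) , apart 0F 1F (λ ()) , apart 0F 2F (λ ()) , apart 1F 2F (λ ())) ¬T

-- Monochromatic families containing prescribed cells

record Family (M : Array n) (c : Colour) (X : List (Cell n)) (k : ℕ) : Set where
  field
    cells  : Fin k → Cell n
    inj    : Inj cells
    mono   : ∀ t → M (cells t) ≡ c
    covers : ∀ {x} → x ∈ X → ∃[ t ] cells t ≡ x
open Family

hits? : (f : Fin k → Cell n) → ∀ x → Dec (∃[ t ] f t ≡ x)
hits? f x = any? (λ t → ≡-dec _≟_ _≟_ (f t) x)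

∷-inj : {B : Set} (b : B) (f : Fin k → B) → Inj f → (∀ t → f t ≢ b) → Inj (b Vector.∷ f)
∷-inj b f f-inj f≢b {zero}  {zero}  _  = refl
∷-inj b f f-inj f≢b {zero}  {suc t} eq = contradiction (sym eq) (f≢b t)
∷-inj b f f-inj f≢b {suc s} {zero}  eq = contradiction eq (f≢b s)
∷-inj b f f-inj f≢b {suc s} {suc t} eq = cong suc (f-inj eq)

∷-family : {M : Array n} {c : Colour} {X Y : List (Cell n)} → ∀ x → M x ≡ c → (F : Family M c X k) →
  ¬ (∃[ t ] cells F t ≡ x) → (∀ {y} → y ∈ Y → y ≡ x ⊎ y ∈ X) → Family M c Y (suc k)
∷-family {M = M} {c} {Y = Y} x Mx F x∉F Y⊆ = record
  { cells  = x Vector.∷ cells F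
  ; inj    = ∷-inj x (cells F) (inj F) (λ t eq → x∉F (t , eq))
  ; mono   = λ { zero → Mx ; (suc t) → mono F t }
  ; covers = λ y∈Y → [ (λ y≡x → zero , sym y≡x) , (λ y∈X → let t , eq = covers F y∈X in suc t , eq) ]′ (Y⊆ y∈Y)
  }

-- The list may repeat cells, for instance when a triple meets the two chosen rows. Only distinct
-- cells are kept, hence the inequality for `k`.
collect : {M : Array n} {c : Colour} (X : List (Cell n)) → (∀ {x} → x ∈ X → M x ≡ c) →
  ∃[ k ] k ≤ length X × Family M c X k
collect []      _    = 0 , z≤n , record { cells = λ () ; inj = λ { {()} } ; mono = λ () ; covers = λ () }
collect (x ∷ X) mono-X with collect X (mono-X ∘ there)
... | k , k≤ , F with hits? (cells F) x
...   | yes (t , eq) = k , ℕ.m≤n⇒m≤1+n k≤ , record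
  { cells = cells F ; inj = inj F ; mono = mono F
  ; covers = λ { (here y≡x) → t , trans eq (sym y≡x) ; (there y∈X) → covers F y∈X } }
...   | no x∉F = suc k , s≤s k≤ , ∷-family x (mono-X (here refl)) F x∉F
  λ { (here y≡x) → inj₁ y≡x ; (there y∈X) → inj₂ y∈X }

-- A family of fewer than `n` cells misses one of the `n` cells of `A`, which can be added; `d`
-- counts the additions still to be made.
fill : {M : Array n} {c : Colour} {X : List (Cell n)} (A : Fin n → Cell n) → Inj A → (∀ t → M (A t) ≡ c) →
  ∀ d → d + k ≡ n → Family M c X k → Family M c X n
fill A A-inj mono-A zero    refl F = F
fill {n} {k} A A-inj mono-A (suc d) eq F with all? (λ t → hits? (cells F) (A t))
... | yes onto = contradiction (Fin.injective⇒≤ {f = proj₁ ∘ onto} (λ {s} {t} e →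
    A-inj (trans (sym (proj₂ (onto s))) (trans (cong (cells F) e) (proj₂ (onto t))))))
    (ℕ.<⇒≱ (ℕ.≤-trans (s≤s (ℕ.m≤n+m k d)) (ℕ.≤-reflexive eq)))
... | no ¬onto with Fin.¬∀⟶∃¬ n _ (λ t → hits? (cells F) (A t)) ¬onto
...   | t , At∉F = fill A A-inj mono-A d (trans (ℕ.+-suc d k) eq)
          (∷-family (A t) (mono-A t) F At∉F inj₂)

family : {M : Array n} {c : Colour} (A : Fin n → Cell n) → Inj A → (∀ t → M (A t) ≡ c) →
  (X : List (Cell n)) → (∀ {x} → x ∈ X → M x ≡ c) → length X ≤ n → Family M c X n
family A A-inj mono-A X mono-X X≤n with collect X mono-X
... | k , k≤ , F = fill A A-inj mono-A _ (ℕ.m∸n+n≡m (ℕ.≤-trans k≤ X≤n)) F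

-- Choosing two rows

module _ (M : Array n) where

  columns : Colour → Fin n → List (Fin n)
  columns c u = filter (λ j → M (u , j) ≟c c) (allFin n)

  count : Colour → Fin n → ℕ
  count c u = length (columns c u)

  count-+ : ∀ u → count red u + count blue u ≡ n
  count-+ u = trans (go (allFin n)) (length-tabulate id)
    where
    go : ∀ xs → length (filter (λ j → M (u , j) ≟c red) xs) + length (filter (λ j → M (u , j) ≟c blue) xs) ≡ length xs
    go []       = refl
    go (x ∷ xs) with M (u , x)
    ... | red  = cong suc (go xs)
    ... | blue = trans (ℕ.+-suc _ _) (cong suc (go xs))

  rowCells : Colour → Fin n → List (Cell n)
  rowCells c u = map (u ,_) (columns c u)

  rowCells-mono : ∀ {c u x} → x ∈ rowCells c u → M x ≡ c
  rowCells-mono {c} {u} x∈ with ∈-map⁻ (u ,_) x∈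
  ... | j , j∈ , refl = proj₂ (∈-filter⁻ (λ j → M (u , j) ≟c c) {xs = allFin n} j∈)

  ∈-rowCells : ∀ {c u j} → M (u , j) ≡ c → (u , j) ∈ rowCells c u
  ∈-rowCells {c} {u} {j} eq = ∈-map⁺ (u ,_) (∈-filter⁺ (λ j → M (u , j) ≟c c) (∈-allFin j) eq)

  twoColumns : ∀ c u → 2 ≤ count c u → ∃[ i ] ∃[ j ] i ≢ j × M (u , i) ≡ c × M (u , j) ≡ c
  twoColumns c u 2≤ = go (columns c u) 2≤ (filter⁺ (λ j → M (u , j) ≟c c) (allFin⁺ n))
    (λ j∈ → proj₂ (∈-filter⁻ (λ j → M (u , j) ≟c c) {xs = allFin n} j∈))
    where
    go : ∀ xs → 2 ≤ length xs → Unique xs → (∀ {j} → j ∈ xs → M (u , j) ≡ c) →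
      ∃[ i ] ∃[ j ] i ≢ j × M (u , i) ≡ c × M (u , j) ≡ c
    go (i ∷ j ∷ _) _ ((i≢j ∷ _) ∷ _) mono = i , j , i≢j , mono (here refl) , mono (there (here refl))
    go (_ ∷ []) (s≤s ()) _ _

  -- Either the c-cells of the two rows already force properness, or there is
  -- room for adding three cells in general position.
  record Light (c : Colour) (u v : Fin n) : Set where
    constructor light
    field
      u≢v  : u ≢ v
      sum≤ : count c u + count c v ≤ n
      room : (2 ≤ count c u × 2 ≤ count c v) ⊎ (count c u + count c v + 3 ≤ n)

  LightRows : Set
  LightRows = ∃[ c ] ∃[ u ] ∃[ v ] Light c u v

  -- The names refer to red: `many` means that almost the whole row is red.
  data Kind (u : Fin n) : Set where
    few  : count red u ≤ 1 → Kind u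
    many : count blue u ≤ 1 → Kind u
    some : 2 ≤ count red u → 2 ≤ count blue u → Kind u

  kind : ∀ u → Kind u
  kind u with 2 ℕ.≤? count red u | 2 ℕ.≤? count blue u
  ... | yes p | yes q = some p q
  ... | no ¬p | _     = few (ℕ.s≤s⁻¹ (ℕ.≰⇒> ¬p))
  ... | yes _ | no ¬q = many (ℕ.s≤s⁻¹ (ℕ.≰⇒> ¬q))

  roomy : ∀ c u v → u ≢ v → count c u + count c v + 3 ≤ n → Light c u v
  roomy c u v u≢v le = light u≢v (ℕ.≤-trans (ℕ.m≤m+n _ 3) le) (inj₂ le)

  module _ (7≤n : 7 ≤ n) where

    scarce : ∀ c u v → u ≢ v → count c u ≤ 1 → count c v ≤ 1 → LightRows
    scarce c u v u≢v p q = c , u , v , roomy c u v u≢v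
      (ℕ.≤-trans (ℕ.+-monoˡ-≤ 3 (ℕ.+-mono-≤ p q)) (ℕ.≤-trans (ℕ.m≤m+n 5 2) 7≤n))

    -- The two rows have `n + n` cells, so one of the colours occurs at most `n` times in them.
    both-some : ∀ u v → u ≢ v → 2 ≤ count red u → 2 ≤ count blue u → 2 ≤ count red v → 2 ≤ count blue v → LightRows
    both-some u v u≢v ru bu rv bv with count red u + count red v ℕ.≤? n
    ... | yes le = red , u , v , light u≢v le (inj₁ (ru , rv))
    ... | no ¬le = blue , u , v , light u≢v le′ (inj₁ (bu , bv))
      where
      total : (count red u + count red v) + (count blue u + count blue v) ≡ n + n
      total = trans (interchange ℕ.+-commutativeSemigroup (count red u) (count red v) (count blue u) (count blue v))
                    (cong₂ _+_ (count-+ u) (count-+ v))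
      le′ : count blue u + count blue v ≤ n
      le′ = ℕ.+-cancelˡ-≤ n _ _ (ℕ.≤-trans (ℕ.+-monoˡ-≤ _ (ℕ.<⇒≤ (ℕ.≰⇒> ¬le))) (ℕ.≤-reflexive total))

    few-some : ∀ c u v → u ≢ v → count c u ≤ 1 → count c v + 4 ≤ n → LightRows
    few-some c u v u≢v p q = c , u , v , roomy c u v u≢v
      (ℕ.≤-trans (ℕ.+-monoˡ-≤ 3 (ℕ.+-monoˡ-≤ (count c v) p))
        (ℕ.≤-trans (ℕ.≤-reflexive (sym (ℕ.+-suc (count c v) 3))) q))

    -- As `n` is at least 7, the two colours cannot both occur more than `n - 4` times in row `v`. A
    -- colour within this bound is paired with the row where it is scarce: `u` for red, `w` for
    -- blue.
    few-some-many : ∀ u v w → u ≢ v → w ≢ v → count red u ≤ 1 → count blue w ≤ 1 → LightRows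
    few-some-many u v w u≢v w≢v p q with count red v + 4 ℕ.≤? n
    ... | yes le = few-some red u v u≢v p le
    ... | no ¬le = few-some blue w v w≢v q (ℕ.+-cancelˡ-≤ (count red v) _ _
      (ℕ.≤-trans (ℕ.≤-reflexive (trans (sym (ℕ.+-assoc (count red v) _ 4)) (cong (_+ 4) (count-+ v))))
        (ℕ.≤-trans (ℕ.≤-reflexive (ℕ.+-comm n 4)) (ℕ.+-monoˡ-≤ n 4≤))))
      where
      4≤ : 4 ≤ count red v
      4≤ = ℕ.+-cancelʳ-≤ 4 4 (count red v) (ℕ.≤-trans (s≤s 7≤n) (ℕ.≰⇒> ¬le))

    -- Two rows of equal kind suffice; otherwise each of the three kinds occurs exactly once.
    lightRows : ∀ u v w → u ≢ v → u ≢ w → v ≢ w → LightRows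
    lightRows u v w uv uw vw with kind u | kind v | kind w
    ... | few p    | few q    | _        = scarce red u v uv p q
    ... | few p    | _        | few q    = scarce red u w uw p q
    ... | _        | few p    | few q    = scarce red v w vw p q
    ... | many p   | many q   | _        = scarce blue u v uv p q
    ... | many p   | _        | many q   = scarce blue u w uw p q
    ... | _        | many p   | many q   = scarce blue v w vw p q
    ... | some a b | some c d | _        = both-some u v uv a b c d
    ... | some a b | _        | some c d = both-some u w uw a b c d
    ... | _        | some a b | some c d = both-some v w vw a b c d
    ... | few p    | some _ _ | many q   = few-some-many u v w uv (≢-sym vw) p q
    ... | few p    | many q   | some _ _ = few-some-many u w v uw vw p q
    ... | some _ _ | few p    | many q   = few-some-many v u w (≢-sym uv) (≢-sym uw) p q
    ... | some _ _ | many q   | few p    = few-some-many w u v (≢-sym uw) (≢-sym uv) p q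
    ... | many q   | few p    | some _ _ = few-some-many v w u vw uw p q
    ... | many q   | some _ _ | few p    = few-some-many w v u (≢-sym vw) uv p q

-- From light rows to balanced partitions

TwoIn : (Fin k → Cell n) → Fin n → Set
TwoIn A w = ∃[ i ] ∃[ j ] i ≢ j × (∃[ k ] A k ≡ (w , i)) × (∃[ k ] A k ≡ (w , j))

outsideRow : (A : Fin k → Cell n) → ∀ {r c w} → (∀ k → row A k ≡ r ⊎ col A k ≡ c) → w ≢ r → ¬ TwoIn A w
outsideRow A {r} {c} {w} cover w≢r (i , j , i≢j , (k , Ak) , (l , Al)) =
  i≢j (trans (inColumn k Ak) (sym (inColumn l Al)))
  where
  inColumn : ∀ {i} k → A k ≡ (w , i) → i ≡ c
  inColumn k eq with cover k
  ... | inj₁ rk = contradiction (trans (sym (cong proj₁ eq)) rk) w≢r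
  ... | inj₂ ck = trans (sym (cong proj₂ eq)) ck

-- A cross meets every row other than its own in a single cell, and at most one of `u` and `v` is
-- its own row.
twoByTwo⇒proper : (A : Fin n → Cell n) → ∀ u v → u ≢ v → TwoIn A u → TwoIn A v → Proper A
twoByTwo⇒proper A u v u≢v U V (r , c , imp) with u ≟ r
... | yes u≡r = outsideRow A (proj₁ ∘ imp) (λ v≡r → u≢v (trans u≡r (sym v≡r))) V
... | no u≢r  = outsideRow A (proj₁ ∘ imp) u≢r U

hits⇒triple : (A : Fin k → Cell n) → ∀ {x y z} → ∃[ t ] A t ≡ x → ∃[ t ] A t ≡ y → ∃[ t ] A t ≡ z →
  ¬ Share x y → ¬ Share x z → ¬ Share y z → Triple A
hits⇒triple A (a , refl) (b , refl) (c , refl) xy xz yz = a , b , c , xy , xz , yz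

-- The chosen family contains all cells of colour `c` in rows `u` and `v`, as `twoRows⇒other`
-- demands, and is filled up from `A`. It is rainbow because it is proper when both rows have two
-- such cells, and because it contains the triple when there is room for three more.
light⇒partition : 7 ≤ n → (M : Array n) → ∀ c u v → Light M c u v → MonoTriple M c →
  HasProperMonoSet M c → BalancedPartition M
light⇒partition {n} 7≤n M c u v (light u≢v sum≤ room) (x , y , z , (Mx , My , Mz) , xy , xz , yz)
  (A , A-inj , A-mono , _) = choose room
  where
  X : List (Cell n)
  X = rowCells M c u ++ rowCells M c v

  length-X : length X ≡ count M c u + count M c v
  length-X = trans (length-++ (rowCells M c u))
    (cong₂ _+_ (length-map (u ,_) (columns M c u)) (length-map (v ,_) (columns M c v)))

  mono-X : ∀ {w} → w ∈ X → M w ≡ c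
  mono-X w∈ = [ rowCells-mono M , rowCells-mono M ]′ (∈-++⁻ (rowCells M c u) w∈)

  X-u : ∀ {j} → M (u , j) ≡ c → (u , j) ∈ X
  X-u eq = ∈-++⁺ˡ (∈-rowCells M eq)

  X-v : ∀ {j} → M (v , j) ≡ c → (v , j) ∈ X
  X-v eq = ∈-++⁺ʳ (rowCells M c u) (∈-rowCells M eq)

  finish : ∀ {Y} → (∀ {w} → w ∈ X → w ∈ Y) → (F : Family M c Y n) → Rainbow (cells F) → BalancedPartition M
  finish X⊆Y F (L , latin , L-inj) = latin⇒partition M L latin
    (rainbow⇒balancing M c (cells F) (mono F) L L-inj
      (twoRows⇒other M c (cells F) L latin L-inj u v u≢v
        (λ j eq → covers F (X⊆Y (X-u eq))) (λ j eq → covers F (X⊆Y (X-v eq)))))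

  viaProper : 2 ≤ count M c u → 2 ≤ count M c v → Family M c X n → BalancedPartition M
  viaProper 2≤u 2≤v F = finish id F (rainbow-proper 7≤n (cells F) (inj F)
      (twoByTwo⇒proper (cells F) u v u≢v (two u 2≤u X-u) (two v 2≤v X-v)))
    where
    two : ∀ w → 2 ≤ count M c w → (∀ {j} → M (w , j) ≡ c → (w , j) ∈ X) → TwoIn (cells F) w
    two w 2≤w X-w with twoColumns M c w 2≤w
    ... | i , j , i≢j , p , q = i , j , i≢j , covers F (X-w p) , covers F (X-w q)

  T : List (Cell n)
  T = x ∷ y ∷ z ∷ []

  mono-T : ∀ {w} → w ∈ T → M w ≡ c
  mono-T (here refl)                 = Mx
  mono-T (there (here refl))         = My
  mono-T (there (there (here refl))) = Mz

  viaTriple : Family M c (X ++ T) n → BalancedPartition M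
  viaTriple F = finish ∈-++⁺ˡ F (rainbow-triple (cells F) (inj F) (hits⇒triple (cells F)
      (covers F (∈-++⁺ʳ X (here refl))) (covers F (∈-++⁺ʳ X (there (here refl))))
      (covers F (∈-++⁺ʳ X (there (there (here refl))))) xy xz yz))

  choose : (2 ≤ count M c u × 2 ≤ count M c v) ⊎ (count M c u + count M c v + 3 ≤ n) → BalancedPartition M
  choose (inj₁ (2≤u , 2≤v)) = viaProper 2≤u 2≤v
    (family A A-inj A-mono X mono-X (ℕ.≤-trans (ℕ.≤-reflexive length-X) sum≤))
  choose (inj₂ sum+3≤n)     = viaTriple
    (family A A-inj A-mono (X ++ T) (λ w∈ → [ mono-X , mono-T ]′ (∈-++⁻ X w∈))
      (ℕ.≤-trans (ℕ.≤-reflexive (trans (length-++ X) (cong (_+ 3) length-X))) sum+3≤n))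

¬triple⇒partition : 7 ≤ n → (M : Array n) → ∀ c → ¬ MonoTriple M c → HasProperMonoSet M c → BalancedPartition M
¬triple⇒partition 7≤n@(s≤s (s≤s (s≤s _))) M c ¬T (A , A-inj , A-mono , proper) =
  finish (rainbow-proper 7≤n A A-inj proper)
  where
  finish : Rainbow A → BalancedPartition M
  finish (L , latin , L-inj) = latin⇒partition M L latin
    (rainbow⇒balancing M c A A-mono L L-inj (¬triple⇒other M c ¬T L latin))

-- Counting dictates the colour of the light rows, so triples of both colours must be at hand before
-- these rows are chosen. A colour without a triple settles the matter at once.
proper⇒partition : 7 ≤ n → (M : Array n) → (∀ c → HasProperMonoSet M c) → BalancedPartition M
proper⇒partition 7≤n@(s≤s (s≤s (s≤s _))) M proper = decide (monoTriple? M red) (monoTriple? M blue)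
  where
  choose : (∀ c → MonoTriple M c) → LightRows M → BalancedPartition M
  choose T (c , u , v , l) = light⇒partition 7≤n M c u v l (T c) (proper c)

  decide : Dec (MonoTriple M red) → Dec (MonoTriple M blue) → BalancedPartition M
  decide (no ¬T) _       = ¬triple⇒partition 7≤n M red ¬T (proper red)
  decide (yes _) (no ¬T) = ¬triple⇒partition 7≤n M blue ¬T (proper blue)
  decide (yes R) (yes B) = choose (λ { red → R ; blue → B })
    (lightRows M 7≤n 0F 1F 2F (λ ()) (λ ()) (λ ()))

-- The diagonal through (i , j) meets the cross of (i , j) in no other cell.
partition⇒proper : (M : Array n) → BalancedPartition M → ∀ c → HasProperMonoSet M c
partition⇒proper {n} M (D , balanced , partition) c = A , A-inj , (λ k → proj₂ (balanced k c)) , proper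
  where
  A : Fin n → Cell n
  A k = proj₁ (balanced k c) , D k ⟨$⟩ʳ proj₁ (balanced k c)
  A-inj : Inj A
  A-inj {a} {b} eq with partition (A a)
  ... | _ , _ , unique = trans (unique a refl) (sym (unique b A-a∈))
    where
    A-a∈ : A a ∈D D b
    A-a∈ = trans (cong (D b ⟨$⟩ʳ_) (cong proj₁ eq)) (sym (cong proj₂ eq))
  proper : Proper A
  proper (i , j , imp) with partition (i , j)
  ... | k , Dki≡j , _ with imp k
  ...   | inj₁ r , ¬eq = ¬eq (cong₂ _,_ r (trans (cong (D k ⟨$⟩ʳ_) r) Dki≡j))
  ...   | inj₂ s , ¬eq = ¬eq (cong₂ _,_ r s)
    where
    r : row A k ≡ i
    r = trans (sym (inverseˡ (D k))) (trans (cong (D k ⟨$⟩ˡ_) (trans s (sym Dki≡j))) (inverseˡ (D k)))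

theorem1 : (n : ℕ) → 7 ≤ n → (M : Array n) →
    BalancedPartition M ⇔ ((c : Colour) → HasProperMonoSet M c)
theorem1 n 7≤n M = mk⇔ (partition⇒proper M) (proper⇒partition 7≤n M)
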